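{- For every prime number $p$ there is an equivariant definable set $X$ in $\mathbf{ZFA}(\mathcal{G}_{\mathcal{F}_p})$ such that the vector space $\mathcal{F}_p^X$ does not have a basis (in $\mathbf{ZFA}(\mathcal{G}_{\mathcal{F}_p})$).
   Context: Let $\mathcal{F}_p$ be the field with $p$ elements. Let $V$ and $V^*$ be two disjoint $\aleph_0$-dimensional vector spaces over $\mathcal{F}_p$ and $\Phi:V\times V^*\to\mathcal{F}_p$ a bilinear map satisfying the Space Extension Axiom: for every finite linearly independent sequence $v_1,\dots,v_k$ in $V$ (resp. $V^*$), scalars $r_1,\dots,r_k\in\mathcal{F}_p$, and finite set $W\subseteq V^*$ (resp. $W\subseteq V$), there is $w\notin W$ with $\Phi(v_i,w)=r_i$ (resp. $\Phi(w,v_i)=r_i$) for all $i$. The polar geometry is the structure $\mathcal{G}_{\mathcal{F}_p}=\langle V\cup V^*,B,\Phi,+,(-)r\ (r\in\mathcal{F}_p)\rangle$, where $+$ and scalar multiplication are interpreted separately on $V$ and $V^*$ and the unary predicate $B$ holds exactly on $V$. $\mathbf{ZFA}(\mathcal{G}_{\mathcal{F}_p})$ is the permutation model with atoms $V\cup V^*$ consisting of hereditarily finitely supported sets (supported by finite $A_0$ = fixed by all automorphisms of the structure fixing $A_0$ pointwise). A set is equivariant if fixed by all automorphisms, and an equivariant set is definable if it has finitely many orbits. $\mathcal{F}_p^X$ is the vector space of finitely supported functions $X\to\mathcal{F}_p$, and a basis must be a finitely supported set. -}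

module Defs where

open import Algebra.Bundles using (Ring; CommutativeRing)
open import Algebra.Module.Bundles using (LeftModule)
open import Algebra.Module.Construct.TensorUnit using () renaming (leftModule to tensorUnit)
open import Algebra.Module.Morphism.Structures using (IsLeftModuleHomomorphism; IsLeftModuleIsomorphism)
import Algebra.Properties.CommutativeMonoid.Sum as Sum
open import Data.Empty using (⊥)
open import Data.Fin.Base using (Fin; toℕ)
open import Data.Fin.Properties using (toℕ-injective; toℕ-fromℕ<; toℕ<n)
open import Data.List.Base using (List; _++_)
open import Data.List.Relation.Unary.All using (All)
open import Data.List.Relation.Unary.All.Properties using (++⁻ˡ; ++⁻ʳ)
import Data.List.Membership.Setoid as SetoidMembership
open import Data.Nat.Base as ℕ using (ℕ; zero; suc; NonZero; _∸_)
open import Data.Nat.DivMod using (_mod_; _%_; m%n<n; m<n⇒m%n≡m; %-distribˡ-+; %-distribˡ-*; n%n≡0)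
import Data.Nat.Properties as ℕₚ
open import Data.Product.Base using (Σ-syntax; ∃-syntax; _×_; _,_; proj₁; proj₂)
open import Data.Sum.Base using (_⊎_; inj₁; inj₂) renaming (map to ⊎-map)
open import Data.Sum.Relation.Binary.Pointwise using (_⊎ₛ_)
open import Data.Unit.Base using (⊤; tt)
open import Function.Base using (_∘_)
open import Function.Definitions using (Injective)
open import Level using (Level; 0ℓ; _⊔_) renaming (suc to lsuc)
open import Relation.Binary.Bundles using (Setoid)
open import Relation.Binary.PropositionalEquality
  using (_≡_; refl; sym; trans; cong; cong₂; isEquivalence; module ≡-Reasoning)
open import Relation.Nullary.Negation using (¬_)
open import Relation.Unary using (Pred)

-- ℤ/p on Fin p; it is the field with p elements when p is prime.

module _ (p : ℕ) .{{_ : NonZero p}} where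

  private
    F : Set
    F = Fin p

    [_] : ℕ → F
    [ n ] = n mod p

    _+F_ _*F_ : F → F → F
    x +F y = [ toℕ x ℕ.+ toℕ y ]
    x *F y = [ toℕ x ℕ.* toℕ y ]

    -F_ : F → F
    -F x = [ p ∸ toℕ x ]

    toℕ-[] : ∀ n → toℕ [ n ] ≡ n % p
    toℕ-[] n = toℕ-fromℕ< (m%n<n n p)

    []-toℕ : ∀ x → [ toℕ x ] ≡ x
    []-toℕ x = toℕ-injective (trans (toℕ-[] (toℕ x)) (m<n⇒m%n≡m (toℕ<n x)))

    []-+ : ∀ m n → [ m ] +F [ n ] ≡ [ m ℕ.+ n ]
    []-+ m n = toℕ-injective (begin
      toℕ ([ m ] +F [ n ])            ≡⟨ toℕ-[] _ ⟩
      (toℕ [ m ] ℕ.+ toℕ [ n ]) % p   ≡⟨ cong₂ (λ a b → (a ℕ.+ b) % p) (toℕ-[] m) (toℕ-[] n) ⟩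
      (m % p ℕ.+ n % p) % p           ≡⟨ %-distribˡ-+ m n p ⟨
      (m ℕ.+ n) % p                   ≡⟨ toℕ-[] _ ⟨
      toℕ [ m ℕ.+ n ]                 ∎)
      where open ≡-Reasoning

    []-* : ∀ m n → [ m ] *F [ n ] ≡ [ m ℕ.* n ]
    []-* m n = toℕ-injective (begin
      toℕ ([ m ] *F [ n ])            ≡⟨ toℕ-[] _ ⟩
      (toℕ [ m ] ℕ.* toℕ [ n ]) % p   ≡⟨ cong₂ (λ a b → (a ℕ.* b) % p) (toℕ-[] m) (toℕ-[] n) ⟩
      ((m % p) ℕ.* (n % p)) % p       ≡⟨ %-distribˡ-* m n p ⟨
      (m ℕ.* n) % p                   ≡⟨ toℕ-[] _ ⟨
      toℕ [ m ℕ.* n ]                 ∎)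
      where open ≡-Reasoning

    +-[]ʳ : ∀ x n → x +F [ n ] ≡ [ toℕ x ℕ.+ n ]
    +-[]ʳ x n = trans (cong (_+F [ n ]) (sym ([]-toℕ x))) ([]-+ (toℕ x) n)

    +-[]ˡ : ∀ m y → [ m ] +F y ≡ [ m ℕ.+ toℕ y ]
    +-[]ˡ m y = trans (cong ([ m ] +F_) (sym ([]-toℕ y))) ([]-+ m (toℕ y))

    *-[]ʳ : ∀ x n → x *F [ n ] ≡ [ toℕ x ℕ.* n ]
    *-[]ʳ x n = trans (cong (_*F [ n ]) (sym ([]-toℕ x))) ([]-* (toℕ x) n)

    *-[]ˡ : ∀ m y → [ m ] *F y ≡ [ m ℕ.* toℕ y ]
    *-[]ˡ m y = trans (cong ([ m ] *F_) (sym ([]-toℕ y))) ([]-* m (toℕ y))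

    +F-comm : ∀ x y → x +F y ≡ y +F x
    +F-comm x y = cong [_] (ℕₚ.+-comm (toℕ x) (toℕ y))

    *F-comm : ∀ x y → x *F y ≡ y *F x
    *F-comm x y = cong [_] (ℕₚ.*-comm (toℕ x) (toℕ y))

    +F-assoc : ∀ x y z → (x +F y) +F z ≡ x +F (y +F z)
    +F-assoc x y z = trans (+-[]ˡ _ z)
      (trans (cong [_] (ℕₚ.+-assoc (toℕ x) (toℕ y) (toℕ z))) (sym (+-[]ʳ x _)))

    *F-assoc : ∀ x y z → (x *F y) *F z ≡ x *F (y *F z)
    *F-assoc x y z = trans (*-[]ˡ _ z)
      (trans (cong [_] (ℕₚ.*-assoc (toℕ x) (toℕ y) (toℕ z))) (sym (*-[]ʳ x _)))

    +F-identityˡ : ∀ x → [ 0 ] +F x ≡ x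
    +F-identityˡ x = trans (+-[]ˡ 0 x) ([]-toℕ x)

    *F-identityˡ : ∀ x → [ 1 ] *F x ≡ x
    *F-identityˡ x = trans (*-[]ˡ 1 x) (trans (cong [_] (ℕₚ.+-identityʳ (toℕ x))) ([]-toℕ x))

    *F-distribˡ-+F : ∀ x y z → x *F (y +F z) ≡ (x *F y) +F (x *F z)
    *F-distribˡ-+F x y z = trans (*-[]ʳ x _)
      (trans (cong [_] (ℕₚ.*-distribˡ-+ (toℕ x) (toℕ y) (toℕ z))) (sym ([]-+ _ _)))

    *F-distribʳ-+F : ∀ x y z → (y +F z) *F x ≡ (y *F x) +F (z *F x)
    *F-distribʳ-+F x y z = trans (*F-comm (y +F z) x)
      (trans (*F-distribˡ-+F x y z) (cong₂ _+F_ (*F-comm x y) (*F-comm x z)))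

    [p]≡[0] : [ p ] ≡ [ 0 ]
    [p]≡[0] = toℕ-injective (trans (toℕ-[] p) (trans (n%n≡0 p)
      (sym (trans (toℕ-[] 0) (m<n⇒m%n≡m (ℕ.>-nonZero⁻¹ p))))))

    -F-inverseˡ : ∀ x → (-F x) +F x ≡ [ 0 ]
    -F-inverseˡ x = trans (+-[]ˡ _ x)
      (trans (cong [_] (ℕₚ.m∸n+n≡m (ℕₚ.<⇒≤ (toℕ<n x)))) [p]≡[0])

  𝔽 : CommutativeRing 0ℓ 0ℓ
  𝔽 = record
    { Carrier = Fin p
    ; _≈_ = _≡_
    ; _+_ = _+F_
    ; _*_ = _*F_
    ; -_ = -F_
    ; 0# = [ 0 ]
    ; 1# = [ 1 ]
    ; isCommutativeRing = record
      { isRing = record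
        { +-isAbelianGroup = record
          { isGroup = record
            { isMonoid = record
              { isSemigroup = record
                { isMagma = record { isEquivalence = isEquivalence ; ∙-cong = cong₂ _+F_ }
                ; assoc = +F-assoc }
              ; identity = +F-identityˡ , λ x → trans (+F-comm x [ 0 ]) (+F-identityˡ x) }
            ; inverse = -F-inverseˡ , λ x → trans (+F-comm x (-F x)) (-F-inverseˡ x)
            ; ⁻¹-cong = cong -F_ }
          ; comm = +F-comm }
        ; *-cong = cong₂ _*F_
        ; *-assoc = *F-assoc
        ; *-identity = *F-identityˡ , λ x → trans (*F-comm x [ 1 ]) (*F-identityˡ x)
        ; distrib = *F-distribˡ-+F , *F-distribʳ-+F }
      ; *-comm = *F-comm }
    }

  VectorSpace : Set₁
  VectorSpace = LeftModule (CommutativeRing.ring 𝔽) 0ℓ 0ℓ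

module _ {r ℓr m ℓm} {R : Ring r ℓr} (M : LeftModule R m ℓm) where
  private module R = Ring R
  open LeftModule M
  open Sum +ᴹ-commutativeMonoid using (sum)

  linearCombination : ∀ {k} → (Fin k → R.Carrier) → (Fin k → Carrierᴹ) → Carrierᴹ
  linearCombination c v = sum (λ i → c i *ₗ v i)

  LinearlyIndependent : ∀ {k} → (Fin k → Carrierᴹ) → Set (r ⊔ ℓr ⊔ ℓm)
  LinearlyIndependent v = ∀ c → linearCombination c v ≈ᴹ 0ᴹ → ∀ i → c i R.≈ R.0#

  record IsBasis {b} (B : Pred Carrierᴹ b) : Set (r ⊔ ℓr ⊔ m ⊔ ℓm ⊔ b) where
    field
      independent : ∀ {k} (v : Fin k → Carrierᴹ) → (∀ i → B (v i)) →
                    Injective _≡_ _≈ᴹ_ v → LinearlyIndependent v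
      spanning    : ∀ x → ∃[ k ] Σ[ c ∈ (Fin k → R.Carrier) ] Σ[ v ∈ (Fin k → Carrierᴹ) ]
                    (∀ i → B (v i)) × x ≈ᴹ linearCombination c v

  -- ℵ₀-dimensional: there is a basis e₀, e₁, e₂, …
  record HasSequenceBasis : Set (r ⊔ ℓr ⊔ m ⊔ ℓm) where
    field
      e           : ℕ → Carrierᴹ
      independent : ∀ k → LinearlyIndependent {k} (e ∘ toℕ)
      spanning    : ∀ x → ∃[ k ] Σ[ c ∈ (Fin k → R.Carrier) ] x ≈ᴹ linearCombination c (e ∘ toℕ)

record PolarGeometry (p : ℕ) .{{_ : NonZero p}} : Set₁ where
  field
    V V* : VectorSpace p

  module V  = LeftModule V
  module V* = LeftModule V*

  private
    module 𝔽ₗ = LeftModule (tensorUnit {R = CommutativeRing.ring (𝔽 p)})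
    module ∈V  = SetoidMembership V.≈ᴹ-setoid
    module ∈V* = SetoidMembership V*.≈ᴹ-setoid

  field
    dim-V  : HasSequenceBasis V
    dim-V* : HasSequenceBasis V*

    Φ       : V.Carrierᴹ → V*.Carrierᴹ → Fin p
    linearˡ : ∀ w → IsLeftModuleHomomorphism V.rawLeftModule 𝔽ₗ.rawLeftModule (λ v → Φ v w)
    linearʳ : ∀ v → IsLeftModuleHomomorphism V*.rawLeftModule 𝔽ₗ.rawLeftModule (λ w → Φ v w)

    -- Space Extension Axiom, in both directions
    extend-V  : ∀ {k} (v : Fin k → V.Carrierᴹ) → LinearlyIndependent V v →
                (r : Fin k → Fin p) (W : List V*.Carrierᴹ) →
                ∃[ w ] w ∈V*.∉ W × (∀ i → Φ (v i) w ≡ r i)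
    extend-V* : ∀ {k} (v : Fin k → V*.Carrierᴹ) → LinearlyIndependent V* v →
                (r : Fin k → Fin p) (W : List V.Carrierᴹ) →
                ∃[ w ] w ∈V.∉ W × (∀ i → Φ w (v i) ≡ r i)

module ZFA {p : ℕ} .{{_ : NonZero p}} (G : PolarGeometry p) where
  open PolarGeometry G

  atoms : Setoid 0ℓ 0ℓ
  atoms = V.≈ᴹ-setoid ⊎ₛ V*.≈ᴹ-setoid

  open Setoid atoms public using () renaming (Carrier to Atom; _≈_ to _≈ᴬ_)
  private module ᴬ = Setoid atoms

  -- A permutation of V ∪ V* respecting the predicate B is a pair of
  -- permutations, one of V and one of V*.
  record Automorphism : Set where
    field
      onV         : V.Carrierᴹ → V.Carrierᴹ
      onV*        : V*.Carrierᴹ → V*.Carrierᴹ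
      isoV        : IsLeftModuleIsomorphism V.rawLeftModule V.rawLeftModule onV
      isoV*       : IsLeftModuleIsomorphism V*.rawLeftModule V*.rawLeftModule onV*
      preserves-Φ : ∀ v w → Φ (onV v) (onV* w) ≡ Φ v w

    onAtom : Atom → Atom
    onAtom = ⊎-map onV onV*

  Fixes : Automorphism → List Atom → Set
  Fixes σ = All (λ a → Automorphism.onAtom σ a ≈ᴬ a)

  -- The cumulative hierarchy over the atoms: set I x stands for the set
  -- { x i ∣ i : I }, and equality _≈_ is extensional.
  data 𝕍 : Set₁ where
    atom : Atom → 𝕍
    set  : (I : Set) → (I → 𝕍) → 𝕍

  infix 4 _≈_ _∈_ _⊆_
  infixr 8 _•_

  _≈_ : 𝕍 → 𝕍 → Set
  atom a  ≈ atom b  = a ≈ᴬ b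
  atom _  ≈ set _ _ = ⊥
  set _ _ ≈ atom _  = ⊥
  set I x ≈ set J y = (∀ i → ∃[ j ] x i ≈ y j) × (∀ j → ∃[ i ] x i ≈ y j)

  IsSet : 𝕍 → Set
  IsSet (atom _)  = ⊥
  IsSet (set _ _) = ⊤

  -- Indices of the elements; atoms have no elements.
  Index : 𝕍 → Set
  Index (atom _)  = ⊥
  Index (set I _) = I

  element : (x : 𝕍) → Index x → 𝕍
  element (set _ x) i = x i

  _∈_ : 𝕍 → 𝕍 → Set
  y ∈ x = ∃[ i ] y ≈ element x i

  _⊆_ : 𝕍 → 𝕍 → Set
  x ⊆ y = ∀ i → element x i ∈ y

  _•_ : Automorphism → 𝕍 → 𝕍
  σ • atom a  = atom (Automorphism.onAtom σ a)
  σ • set I x = set I (λ i → σ • x i)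

  Supports : List Atom → 𝕍 → Set
  Supports A x = ∀ σ → Fixes σ A → σ • x ≈ x

  FinitelySupported : 𝕍 → Set
  FinitelySupported x = ∃[ A ] Supports A x

  HereditarilyFinitelySupported : 𝕍 → Set
  HereditarilyFinitelySupported (atom _)  = ⊤
  HereditarilyFinitelySupported (set I x) =
    FinitelySupported (set I x) × (∀ i → HereditarilyFinitelySupported (x i))

  IsZFASet : 𝕍 → Set
  IsZFASet x = IsSet x × HereditarilyFinitelySupported x

  Equivariant : 𝕍 → Set
  Equivariant x = ∀ σ → σ • x ≈ x

  FinitelyManyOrbits : 𝕍 → Set
  FinitelyManyOrbits x = ∃[ n ] Σ[ r ∈ (Fin n → Index x) ]
    ∀ i → ∃[ j ] ∃[ σ ] σ • element x (r j) ≈ element x i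

  Definable : 𝕍 → Set
  Definable x = Equivariant x × FinitelyManyOrbits x

  ❴_❵ : 𝕍 → 𝕍
  ❴ x ❵ = set ⊤ (λ _ → x)

  ⁅_∣_⁆ : 𝕍 → 𝕍 → 𝕍
  ⁅ x ∣ y ⁆ = set (⊤ ⊎ ⊤) (λ { (inj₁ _) → x ; (inj₂ _) → y })

  ⟨_,_⟩ : 𝕍 → 𝕍 → 𝕍
  ⟨ x , y ⟩ = ⁅ ❴ x ❵ ∣ ⁅ x ∣ y ⁆ ⁆

  -- Zermelo numerals: the element k of Fin p is represented in the model by
  -- the pure (hence equivariant) set numeral k.
  numeral : ℕ → 𝕍
  numeral zero    = set ⊥ (λ ())
  numeral (suc n) = ❴ numeral n ❵

  graph : (X : 𝕍) → (Index X → Fin p) → 𝕍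
  graph X f = set (Index X) (λ i → ⟨ element X i , numeral (toℕ (f i)) ⟩)

  record Function (X : 𝕍) : Set where
    constructor function
    field
      value             : Index X → Fin p
      extensional       : ∀ i j → element X i ≈ element X j → value i ≡ value j
      finitelySupported : FinitelySupported (graph X value)

    asSet : 𝕍
    asSet = graph X value

  open Function

  infix 9 𝔽^_
  𝔽^_ : 𝕍 → 𝕍
  𝔽^ X = set (Function X) asSet

  ≈-refl : ∀ x → x ≈ x
  ≈-refl (atom a)  = ᴬ.refl
  ≈-refl (set I x) = (λ i → i , ≈-refl (x i)) , (λ i → i , ≈-refl (x i))

  ≈-sym : ∀ {x y} → x ≈ y → y ≈ x
  ≈-sym {atom a}  {atom b}  p = ᴬ.sym p
  ≈-sym {set I x} {set J y} (f , g) =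
    (λ j → proj₁ (g j) , ≈-sym (proj₂ (g j))) , (λ i → proj₁ (f i) , ≈-sym (proj₂ (f i)))

  ≈-trans : ∀ {x y z} → x ≈ y → y ≈ z → x ≈ z
  ≈-trans {atom a}  {atom b}  {atom c}  p q = ᴬ.trans p q
  ≈-trans {set I x} {set J y} {set K z} (f , g) (h , k) =
    (λ i → proj₁ (h (proj₁ (f i))) , ≈-trans (proj₂ (f i)) (proj₂ (h (proj₁ (f i))))) ,
    (λ l → proj₁ (g (proj₁ (k l))) , ≈-trans (proj₂ (g (proj₁ (k l)))) (proj₂ (k l)))

  ❴❵-injective : ∀ {x y} → ❴ x ❵ ≈ ❴ y ❵ → x ≈ y
  ❴❵-injective (f , _) = proj₂ (f tt)

  numeral-injective : ∀ m n → numeral m ≈ numeral n → m ≡ n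
  numeral-injective zero    zero    _       = refl
  numeral-injective zero    (suc n) (_ , g) with () ← proj₁ (g tt)
  numeral-injective (suc m) zero    (f , _) with () ← proj₁ (f tt)
  numeral-injective (suc m) (suc n) e       = cong suc (numeral-injective m n (❴❵-injective e))

  numeral-fixed : ∀ σ n → σ • numeral n ≈ numeral n
  numeral-fixed σ zero    = (λ ()) , (λ ())
  numeral-fixed σ (suc n) = (λ _ → tt , numeral-fixed σ n) , (λ _ → tt , numeral-fixed σ n)

  ❴❵-cong : ∀ {x y} → x ≈ y → ❴ x ❵ ≈ ❴ y ❵
  ❴❵-cong e = (λ _ → tt , e) , (λ _ → tt , e)

  -- Pairs are compared in the form in which σ • ⟨ x , y ⟩ arises.
  module _ (σ : Automorphism) where

    pair-cong : ∀ {x y x′ y′} → σ • x ≈ x′ → σ • y ≈ y′ → σ • ⟨ x , y ⟩ ≈ ⟨ x′ , y′ ⟩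
    pair-cong {x} {y} {x′} {y′} xx′ yy′ =
      (λ { (inj₁ _) → inj₁ tt , ❴❵-cong xx′ ; (inj₂ _) → inj₂ tt , d }) ,
      (λ { (inj₁ _) → inj₁ tt , ❴❵-cong xx′ ; (inj₂ _) → inj₂ tt , d })
      where
      d : σ • ⁅ x ∣ y ⁆ ≈ ⁅ x′ ∣ y′ ⁆
      d = (λ { (inj₁ _) → inj₁ tt , xx′ ; (inj₂ _) → inj₂ tt , yy′ }) ,
          (λ { (inj₁ _) → inj₁ tt , xx′ ; (inj₂ _) → inj₂ tt , yy′ })

    pair-injective₁ : ∀ {x y x′ y′} → σ • ⟨ x , y ⟩ ≈ ⟨ x′ , y′ ⟩ → σ • x ≈ x′
    pair-injective₁ (f , _) with f (inj₁ tt)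
    ... | inj₁ _ , (g , _) = proj₂ (g tt)
    ... | inj₂ _ , (_ , g) = proj₂ (g (inj₁ tt))

    pair-injective₂ : ∀ {x y x′ y′} → σ • ⟨ x , y ⟩ ≈ ⟨ x′ , y′ ⟩ → σ • y ≈ y′
    pair-injective₂ {x} {y} {x′} {y′} e@(f , g) = go
      where
      xx′ : σ • x ≈ x′
      xx′ = pair-injective₁ {x} {y} {x′} {y′} e

      go : σ • y ≈ y′
      go with f (inj₂ tt)
      ... | inj₂ _ , (h , _) with h (inj₂ tt)
      ...   | inj₂ _ , yy′ = yy′
      ...   | inj₁ _ , yy′ with g (inj₂ tt)
      ...     | inj₁ _ , (_ , k) = ≈-trans yy′ (≈-trans (≈-sym xx′) (proj₂ (k (inj₂ tt))))
      ...     | inj₂ _ , (_ , k) with k (inj₂ tt)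
      ...       | inj₁ _ , s = ≈-trans yy′ (≈-trans (≈-sym xx′) s)
      ...       | inj₂ _ , s = s
      go | inj₁ _ , (h , _) with g (inj₂ tt)
      ...   | inj₁ _ , (_ , k) =
                ≈-trans (proj₂ (h (inj₂ tt))) (≈-trans (≈-sym xx′) (proj₂ (k (inj₂ tt))))
      ...   | inj₂ _ , (_ , k) with k (inj₂ tt)
      ...     | inj₁ _ , s = ≈-trans (proj₂ (h (inj₂ tt))) (≈-trans (≈-sym xx′) s)
      ...     | inj₂ _ , s = s

  Invariant : (X : 𝕍) → (Index X → Fin p) → Automorphism → Set
  Invariant X f σ = ∀ i j → σ • element X i ≈ element X j → f i ≡ f j

  Permutes : 𝕍 → Automorphism → Set
  Permutes X σ = (∀ i → ∃[ j ] σ • element X i ≈ element X j) ×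
                 (∀ j → ∃[ i ] σ • element X i ≈ element X j)

  permutes : ∀ X {σ} → σ • X ≈ X → Permutes X σ
  permutes (atom _)  _ = (λ ()) , (λ ())
  permutes (set _ _) e = e

  graph-fixed : ∀ X {f σ} → Permutes X σ → Invariant X f σ → σ • graph X f ≈ graph X f
  graph-fixed X {f} {σ} (to , from) inv =
    (λ i → let j , e = to i   in j , edge i j e) ,
    (λ j → let i , e = from j in i , edge i j e)
    where
    edge : ∀ i j → σ • element X i ≈ element X j →
           σ • ⟨ element X i , numeral (toℕ (f i)) ⟩ ≈ ⟨ element X j , numeral (toℕ (f j)) ⟩
    edge i j e rewrite inv i j e =
      pair-cong σ {element X i} {numeral (toℕ (f j))} e (numeral-fixed σ (toℕ (f j)))

  graph-invariant : ∀ {X} (f : Function X) {σ} →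
                    σ • asSet f ≈ asSet f → Invariant X (value f) σ
  graph-invariant {X} f {σ} (to , _) i j e with to i
  ... | k , q = trans
    (toℕ-injective (numeral-injective _ _
      (≈-trans (≈-sym (numeral-fixed σ (toℕ (value f i)))) (pair-injective₂ σ {x} {y} {x′} {y′} q))))
    (extensional f k j (≈-trans (≈-sym (pair-injective₁ σ {x} {y} {x′} {y′} q)) e))
    where
    x y x′ y′ : 𝕍
    x  = element X i
    y  = numeral (toℕ (value f i))
    x′ = element X k
    y′ = numeral (toℕ (value f k))

  -- X must be finitely supported for the constant function 0 to be so.
  module _ (X : 𝕍) (S : FinitelySupported X) where
    private
      module K = CommutativeRing (𝔽 p)

      map₁ : (h : Fin p → Fin p) → Function X → Function X
      map₁ h f = function (λ i → h (value f i))
        (λ i j e → cong h (extensional f i j e))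
        (proj₁ S ++ proj₁ (finitelySupported f) , λ σ fix →
          graph-fixed X (permutes X (proj₂ S σ (++⁻ˡ (proj₁ S) fix)))
            (λ i j e → cong h (graph-invariant f
              (proj₂ (finitelySupported f) σ (++⁻ʳ (proj₁ S) fix)) i j e)))

      map₂ : (h : Fin p → Fin p → Fin p) → Function X → Function X → Function X
      map₂ h f g = function (λ i → h (value f i) (value g i))
        (λ i j e → cong₂ h (extensional f i j e) (extensional g i j e))
        (proj₁ S ++ A ++ proj₁ (finitelySupported g) , λ σ fix →
          let fix′ = ++⁻ʳ (proj₁ S) fix in
          graph-fixed X (permutes X (proj₂ S σ (++⁻ˡ (proj₁ S) fix)))
            (λ i j e → cong₂ h
              (graph-invariant f (proj₂ (finitelySupported f) σ (++⁻ˡ A fix′)) i j e)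
              (graph-invariant g (proj₂ (finitelySupported g) σ (++⁻ʳ A fix′)) i j e)))
        where
        A : List Atom
        A = proj₁ (finitelySupported f)

      constant : Fin p → Function X
      constant c = function (λ _ → c) (λ _ _ _ → refl)
        (proj₁ S , λ σ fix → graph-fixed X (permutes X (proj₂ S σ fix)) (λ _ _ _ → refl))

    functionSpace : VectorSpace p
    functionSpace = record
      { Carrierᴹ = Function X
      ; _≈ᴹ_ = λ f g → ∀ i → value f i ≡ value g i
      ; _+ᴹ_ = map₂ K._+_
      ; _*ₗ_ = λ c → map₁ (c K.*_)
      ; 0ᴹ = constant K.0#
      ; -ᴹ_ = map₁ (λ x → K.- x)
      ; isLeftModule = record
        { isLeftSemimodule = record
          { +ᴹ-isCommutativeMonoid = record
            { isMonoid = record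
              { isSemigroup = record
                { isMagma = record
                  { isEquivalence = record
                    { refl = λ _ → refl
                    ; sym = λ e i → sym (e i)
                    ; trans = λ d e i → trans (d i) (e i) }
                  ; ∙-cong = λ d e i → cong₂ K._+_ (d i) (e i) }
                ; assoc = λ f g h i → K.+-assoc (value f i) (value g i) (value h i) }
              ; identity = (λ f i → K.+-identityˡ (value f i)) , (λ f i → K.+-identityʳ (value f i)) }
            ; comm = λ f g i → K.+-comm (value f i) (value g i) }
          ; isPreleftSemimodule = record
            { *ₗ-cong = λ d e i → cong₂ K._*_ d (e i)
            ; *ₗ-zeroˡ = λ f i → K.zeroˡ (value f i)
            ; *ₗ-distribʳ = λ f c d i → K.distribʳ (value f i) c d
            ; *ₗ-identityˡ = λ f i → K.*-identityˡ (value f i)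
            ; *ₗ-assoc = λ c d f i → K.*-assoc c d (value f i)
            ; *ₗ-zeroʳ = λ c i → K.zeroʳ c
            ; *ₗ-distribˡ = λ c f g i → K.distribˡ c (value f i) (value g i) } }
        ; -ᴹ‿cong = λ e i → cong (λ x → K.- x) (e i)
        ; -ᴹ‿inverse = (λ f i → K.-‿inverseˡ (value f i)) , (λ f i → K.-‿inverseʳ (value f i)) }
      }

    -- A basis in the model: a set B ⊆ 𝔽^ X of the model that is a basis.
    HasZFABasis : Set₁
    HasZFABasis = Σ[ B ∈ 𝕍 ] IsZFASet B × B ⊆ 𝔽^ X × IsBasis functionSpace (λ f → asSet f ∈ B)

  isZFASet⇒finitelySupported : ∀ {x} → IsZFASet x → FinitelySupported x
  isZFASet⇒finitelySupported {set _ _} (_ , s , _) = s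

{-# OPTIONS --safe #-}
module Submission where

-- X is the orbit of a non-zero v₀ ∈ V.  Let B be a basis of 𝔽^ X supported by A.  Choose a ≠ 0 in V
-- orthogonal to A ∩ V*; for b ∈ V* orthogonal to a and to A ∩ V the transvection τ_b : v ↦ v + Φ(v,b)a
-- extends to an automorphism fixing A, so it permutes B.  As (τ_b f)(v) depends on b only through
-- Φ(v,b), every f : X → 𝔽 satisfies Σ_i τ_{ix} f = Σ_i τ_{y+ix} f (i ranging over 𝔽).  For f ∈ B
-- these 2p functions lie in B, so two of them coincide: some ix with i ≠ 0, or some y + ix, fixes f.
-- Hence the b with τ_b f = f have codimension at most 1, and the finitely many f ∈ B in the expansion
-- of Φ(·,w) are fixed by a common τ_b with b ≠ 0.  But if Φ(a,w) = 1, then τ_b fixes Φ(·,w) only for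
-- b = 0.

open import Defs
open import Algebra.Bundles using (CommutativeMonoid; CommutativeRing)
open import Algebra.Module.Bundles using (LeftModule)
import Algebra.Module.Morphism.Construct.Composition as Composition
import Algebra.Module.Morphism.Construct.Identity as Identity
open import Algebra.Module.Construct.TensorUnit using () renaming (leftModule to tensorUnit)
open import Algebra.Module.Morphism.Structures
  using (IsLeftModuleHomomorphism; IsLeftModuleIsomorphism)
import Algebra.Module.Properties.LeftModule as LeftModuleProperties
import Algebra.Properties.CommutativeMonoid.Sum as Sum
import Algebra.Properties.CommutativeSemigroup as CommutativeSemigroupProperties
import Algebra.Properties.Group as GroupProperties
import Algebra.Properties.Ring as RingProperties
import Algebra.Properties.Semiring.Mult as Mult
open import Data.Empty using (⊥-elim)
open import Data.Fin.Base using (Fin; zero; suc; toℕ; join; splitAt; _↑ˡ_; _↑ʳ_)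
open import Data.Fin.Permutation using (permutation)
open import Data.Fin.Properties
  using (toℕ-injective; toℕ-fromℕ<; toℕ<n; splitAt-↑ˡ; splitAt-↑ʳ; join-splitAt; _≟_)
open import Data.List.Base using (List; []; _∷_; allFin; cartesianProductWith)
import Data.List.Membership.Setoid as SetoidMembership
open import Data.List.Membership.Setoid.Properties using (∈-cartesianProductWith⁺; ∈-resp-≈)
open import Data.List.Membership.Propositional.Properties using (∈-allFin)
open import Data.List.Relation.Unary.All as All using (All; []; _∷_)
open import Data.List.Relation.Unary.Any using (here)
open import Data.Nat.Base as ℕ using (ℕ; zero; suc; NonZero)
open import Data.Nat.Coprimality using (coprime-Bézout; prime⇒coprime)
open import Data.Nat.DivMod using (_mod_; _%_; m%n<n; m<n⇒m%n≡m; n%n≡0; %-distribˡ-+)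
open import Data.Nat.GCD using (module Bézout)
import Data.Nat.Properties as ℕₚ
open import Data.Nat.Primality using (Prime; prime⇒nonTrivial)
open import Data.Product.Base using (Σ-syntax; ∃-syntax; _×_; _,_; proj₁; proj₂)
open import Data.Sum.Base using (_⊎_; inj₁; inj₂; [_,_]′)
open import Data.Sum.Relation.Binary.Pointwise using (inj₁; inj₂)
open import Data.Unit.Base using (tt)
import Data.Vec.Functional as Vector
open import Function.Base using (_∘_; _$_)
open import Level using (0ℓ)
open import Relation.Binary.PropositionalEquality
  using (_≡_; _≢_; refl; sym; trans; cong; cong₂; subst; setoid; module ≡-Reasoning)
import Relation.Binary.Reasoning.Setoid as SetoidReasoning
open import Relation.Nullary.Decidable using (yes; no)
open import Relation.Nullary.Negation using (¬_)
open import Relation.Unary using (Pred; U; _∩_; _⊆_)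

-- Sums over a concatenated index set.

module _ {c ℓ} (M : CommutativeMonoid c ℓ) where
  open CommutativeMonoid M renaming (refl to ≈-refl; trans to ≈-trans; sym to ≈-sym)
  open Sum M using (sum)

  sum-↑ : ∀ m {n} (f : Fin (m ℕ.+ n) → Carrier) →
          sum f ≈ sum (λ i → f (i ↑ˡ n)) ∙ sum (λ i → f (m ↑ʳ i))
  sum-↑ zero    f = ≈-sym (identityˡ _)
  sum-↑ (suc m) f = ≈-trans (∙-congˡ (sum-↑ m (f ∘ suc))) (≈-sym (assoc _ _ _))

-- The prime field: characteristic, sums over all scalars, inverses.

module PrimeField (p : ℕ) .{{_ : NonZero p}} (p-prime : Prime p) where
  open CommutativeRing (𝔽 p) public
    using (_+_; _*_; -_; 0#; 1#; ring; +-assoc; +-identityˡ; +-identityʳ; *-assoc; *-comm;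
           *-identityˡ; *-identityʳ; zeroˡ; zeroʳ; distribˡ; distribʳ; -‿inverseˡ; -‿inverseʳ;
           semiring; +-group; +-commutativeMonoid)
  open RingProperties ring public using (-‿distribˡ-*; -1*x≈-x)
  open GroupProperties +-group public using ()
    renaming (inverseˡ-unique to +-inverseˡ-unique; x∙y⁻¹≈ε⇒x≈y to x-y≡0⇒x≡y; ε⁻¹≈ε to -0≡0;
              //-rightDividesˡ to x-y+y≡x; identityʳ-unique to +-identityʳ-unique)
  open Mult semiring using (×-assoc-*; ×1-homo-*) renaming (_×_ to _·_)
  open Sum +-commutativeMonoid public using (sum; sum-replicate; sum-cong-≗; sum-permute; ∑-distrib-+)

  -- Carries the laws of natural multiples over to residues; both characteristic p and the Bézout
  -- argument for inverses rest on it.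
  n·1≡n : ∀ n → n · 1# ≡ n mod p
  n·1≡n zero    = refl
  n·1≡n (suc n) = trans (cong (1# +_) (n·1≡n n)) $ toℕ-injective $ begin
    toℕ (1# + n mod p)                    ≡⟨ toℕ-mod _ ⟩
    (toℕ (1 mod p) ℕ.+ toℕ (n mod p)) % p ≡⟨ cong₂ (λ a b → (a ℕ.+ b) % p) (toℕ-mod 1) (toℕ-mod n) ⟩
    (1 % p ℕ.+ n % p) % p                 ≡⟨ %-distribˡ-+ 1 n p ⟨
    suc n % p                             ≡⟨ toℕ-mod _ ⟨
    toℕ (suc n mod p)                     ∎
    where
    open ≡-Reasoning
    toℕ-mod : ∀ n → toℕ (n mod p) ≡ n % p
    toℕ-mod n = toℕ-fromℕ< (m%n<n n p)

  toℕ·1≡ : ∀ x → toℕ x · 1# ≡ x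
  toℕ·1≡ x = trans (n·1≡n (toℕ x)) (toℕ-injective
    (trans (toℕ-fromℕ< (m%n<n (toℕ x) p)) (m<n⇒m%n≡m (toℕ<n x))))

  p·x≡0 : ∀ x → p · x ≡ 0#
  p·x≡0 x = begin
    p · x         ≡⟨ cong (p ·_) (*-identityˡ x) ⟨
    p · (1# * x)  ≡⟨ ×-assoc-* p 1# x ⟨
    (p · 1#) * x  ≡⟨ cong (_* x) (trans (n·1≡n p) p≡0) ⟩
    0# * x        ≡⟨ zeroˡ x ⟩
    0#            ∎
    where
    open ≡-Reasoning
    p≡0 : p mod p ≡ 0#
    p≡0 = toℕ-injective (trans (toℕ-fromℕ< (m%n<n p p)) (trans (n%n≡0 p)
      (sym (trans (toℕ-fromℕ< (m%n<n 0 p)) (m<n⇒m%n≡m (ℕ.>-nonZero⁻¹ p))))))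

  sum-const≡0 : ∀ {f : Fin p → Fin p} {c} → (∀ i → f i ≡ c) → sum f ≡ 0#
  sum-const≡0 {c = c} e = trans (sum-cong-≗ e) (trans (sum-replicate p) (p·x≡0 c))

  -- Translation by `c` is a permutation of the field.
  sum-shift : ∀ c (f : Fin p → Fin p) → sum f ≡ sum (λ i → f (c + i))
  sum-shift c f = sum-permute f (permutation (c +_) (- c +_)
    (λ i → trans (sym (+-assoc c (- c) i)) (trans (cong (_+ i) (-‿inverseʳ c)) (+-identityˡ i)))
    (λ i → trans (sym (+-assoc (- c) c i)) (trans (cong (_+ i) (-‿inverseˡ c)) (+-identityˡ i))))

  -- After a shift of the first sum the terms cancel in pairs. The factors 1 and -1 stay explicit
  -- because they are the coefficients of the relation in `dependence`.
  sum-difference : ∀ {f g : Fin p → Fin p} c → (∀ i → g i ≡ f (c + i)) →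
                   sum (λ i → 1# * f i) + sum (λ i → - 1# * g i) ≡ 0#
  sum-difference {f} {g} c g≡f = begin
    sum (λ i → 1# * f i) + sum (λ i → - 1# * g i)
      ≡⟨ cong (_+ sum (λ i → - 1# * g i)) (sum-shift c (λ i → 1# * f i)) ⟩
    sum (λ i → 1# * f (c + i)) + sum (λ i → - 1# * g i)
      ≡⟨ ∑-distrib-+ {p} (λ i → 1# * f (c + i)) (λ i → - 1# * g i) ⟨
    sum (λ i → 1# * f (c + i) + - 1# * g i)
      ≡⟨ sum-const≡0 cancel ⟩
    0# ∎
    where
    open ≡-Reasoning
    cancel : ∀ i → 1# * f (c + i) + - 1# * g i ≡ 0#
    cancel i = begin
      1# * f (c + i) + - 1# * g i       ≡⟨ cong (λ t → 1# * t + - 1# * g i) (g≡f i) ⟨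
      1# * g i + - 1# * g i             ≡⟨ cong₂ _+_ (*-identityˡ (g i)) (-1*x≈-x (g i)) ⟩
      g i + - g i                       ≡⟨ -‿inverseʳ (g i) ⟩
      0#                                ∎

  1≢0 : 1# ≢ 0#
  1≢0 e = ℕₚ.1+n≢0 (begin
    1                 ≡⟨ m<n⇒m%n≡m (ℕ.nonTrivial⇒n>1 p {{prime⇒nonTrivial p-prime}}) ⟨
    1 % p             ≡⟨ toℕ-fromℕ< (m%n<n 1 p) ⟨
    toℕ (1 mod p)     ≡⟨ cong toℕ e ⟩
    toℕ (0 mod p)     ≡⟨ toℕ-fromℕ< (m%n<n 0 p) ⟩
    0 % p             ≡⟨ m<n⇒m%n≡m (ℕ.>-nonZero⁻¹ p) ⟩
    0                 ∎)
    where open ≡-Reasoning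

  -- Bézout for the coprime numbers p and `toℕ x`: the coefficient of `toℕ x`, up to sign, is the
  -- inverse, since multiples of p vanish.
  inverse : ∀ {x} → x ≢ 0# → ∃[ y ] y * x ≡ 1#
  inverse {x} x≢0 = go (coprime-Bézout (prime⇒coprime p-prime {{ℕ.≢-nonZero toℕx≢0}} (toℕ<n x)))
    where
    open ≡-Reasoning
    toℕx≢0 : toℕ x ≢ 0
    toℕx≢0 e = x≢0 (trans (sym (toℕ·1≡ x)) (cong (_· 1#) e))

    np≡0 : ∀ n → (n ℕ.* p) · 1# ≡ 0#
    np≡0 n = trans (×1-homo-* n p) (trans (cong (n · 1# *_) (p·x≡0 1#)) (zeroʳ (n · 1#)))

    nx : ∀ n → (n ℕ.* toℕ x) · 1# ≡ n · 1# * x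
    nx n = trans (×1-homo-* n (toℕ x)) (cong (n · 1# *_) (toℕ·1≡ x))

    go : Bézout.Identity 1 p (toℕ x) → ∃[ y ] y * x ≡ 1#
    go (Bézout.-+ m n e) = n · 1# , (begin
      n · 1# * x             ≡⟨ nx n ⟨
      (n ℕ.* toℕ x) · 1#     ≡⟨ cong (_· 1#) e ⟨
      1# + (m ℕ.* p) · 1#    ≡⟨ cong (1# +_) (np≡0 m) ⟩
      1# + 0#                ≡⟨ +-identityʳ 1# ⟩
      1#                     ∎)
    go (Bézout.+- m n e) = - (n · 1#) , trans (sym (-‿distribˡ-* (n · 1#) x))
      (sym (+-inverseˡ-unique 1# (n · 1# * x) (begin
        1# + n · 1# * x            ≡⟨ cong (1# +_) (nx n) ⟨
        1# + (n ℕ.* toℕ x) · 1#    ≡⟨ cong (_· 1#) e ⟩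
        (m ℕ.* p) · 1#             ≡⟨ np≡0 m ⟩
        0#                         ∎)))

  *-solve : ∀ {x} → x ≢ 0# → ∀ y → ∃[ z ] z * x ≡ y
  *-solve {x} x≢0 y = let r , rx≡1 = inverse x≢0 in
    y * r , trans (*-assoc y r x) (trans (cong (y *_) rx≡1) (*-identityʳ y))

  -- Every scalar is a natural multiple of 1; hence additive closure alone makes a subspace in
  -- `IsSubspace`.
  scalar-induction : ∀ {ℓ} (P : Pred (Fin p) ℓ) → P 0# → (∀ {x} → P x → P (1# + x)) → ∀ x → P x
  scalar-induction P P0 Ps x = subst P (toℕ·1≡ x) (go (toℕ x))
    where
    go : ∀ n → P (n · 1#)
    go zero    = P0
    go (suc n) = Ps (go n)

-- Linear algebra over the prime field: independence, subspaces, largeness.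

module SpaceOver {p : ℕ} .{{_ : NonZero p}} (p-prime : Prime p) (M : VectorSpace p) where
  open PrimeField p p-prime
  open LeftModule M public
  open LeftModuleProperties M public using (inverseˡ-uniqueᴹ)
  open GroupProperties +ᴹ-group public using (//-rightDividesʳ)
  open CommutativeSemigroupProperties (CommutativeMonoid.commutativeSemigroup +ᴹ-commutativeMonoid) public
    using (interchange; x∙yz≈y∙xz)
  open SetoidMembership ≈ᴹ-setoid public
  private
    module 𝔽ₗ = LeftModule (tensorUnit {R = CommutativeRing.ring (𝔽 p)})

  Functional : (Carrierᴹ → Fin p) → Set
  Functional = IsLeftModuleHomomorphism rawLeftModule 𝔽ₗ.rawLeftModule

  *ₗ-cancel : ∀ {c x} → c ≢ 0# → c *ₗ x ≈ᴹ 0ᴹ → x ≈ᴹ 0ᴹ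
  *ₗ-cancel {c} {x} c≢0 cx≈0 = let r , rc≡1 = inverse c≢0 in begin
    x              ≈⟨ *ₗ-identityˡ x ⟨
    1# *ₗ x        ≈⟨ *ₗ-cong (sym rc≡1) ≈ᴹ-refl ⟩
    (r * c) *ₗ x   ≈⟨ *ₗ-assoc r c x ⟩
    r *ₗ c *ₗ x    ≈⟨ *ₗ-cong refl cx≈0 ⟩
    r *ₗ 0ᴹ        ≈⟨ *ₗ-zeroʳ r ⟩
    0ᴹ             ∎
    where open SetoidReasoning ≈ᴹ-setoid

  singleton-independent : ∀ {x} → ¬ x ≈ᴹ 0ᴹ → LinearlyIndependent M {1} (λ _ → x)
  singleton-independent x≉0 c cx≈0 zero with c zero ≟ 0#
  ... | yes c≡0 = c≡0
  ... | no  c≢0 = ⊥-elim (x≉0 (*ₗ-cancel c≢0 (≈ᴹ-trans (≈ᴹ-sym (+ᴹ-identityʳ _)) cx≈0)))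

  -- Applying `φ` to a relation isolates the coefficient of `y`; once that is zero, the other
  -- vanishes because `x` is non-zero.
  pair-independent : ∀ {φ} → Functional φ → ∀ {x y} → ¬ x ≈ᴹ 0ᴹ → φ x ≡ 0# → φ y ≡ 1# →
                     LinearlyIndependent M (x Vector.∷ y Vector.∷ Vector.[])
  pair-independent {φ} φ-linear {x} {y} x≉0 φx≡0 φy≡1 c e = λ
    { zero → singleton-independent x≉0 (λ _ → c zero) cx≈0 zero ; (suc zero) → c₁≡0 }
    where
    module φ = IsLeftModuleHomomorphism φ-linear

    c₁≡0 : c (suc zero) ≡ 0#
    c₁≡0 = begin
      c (suc zero)                                              ≡⟨ *-identityʳ _ ⟨
      c (suc zero) * 1#                                         ≡⟨ cong (c (suc zero) *_) φy≡1 ⟨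
      c (suc zero) * φ y                                        ≡⟨ φ.*ₗ-homo _ y ⟨
      φ (c (suc zero) *ₗ y)                                     ≡⟨ φ.⟦⟧-cong (+ᴹ-identityʳ _) ⟨
      φ (c (suc zero) *ₗ y +ᴹ 0ᴹ)                               ≡⟨ +-identityˡ _ ⟨
      0# + φ (c (suc zero) *ₗ y +ᴹ 0ᴹ)                          ≡⟨ cong (_+ _) (zeroʳ (c zero)) ⟨
      c zero * 0# + φ (c (suc zero) *ₗ y +ᴹ 0ᴹ)                 ≡⟨ cong (λ t → c zero * t + _) φx≡0 ⟨
      c zero * φ x + φ (c (suc zero) *ₗ y +ᴹ 0ᴹ)                ≡⟨ cong (_+ _) (φ.*ₗ-homo _ x) ⟨
      φ (c zero *ₗ x) + φ (c (suc zero) *ₗ y +ᴹ 0ᴹ)             ≡⟨ φ.+ᴹ-homo _ _ ⟨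
      φ (c zero *ₗ x +ᴹ (c (suc zero) *ₗ y +ᴹ 0ᴹ))              ≡⟨ φ.⟦⟧-cong e ⟩
      φ 0ᴹ                                                      ≡⟨ φ.0ᴹ-homo ⟩
      0#                                                        ∎
      where open ≡-Reasoning

    c₁y≈0 : c (suc zero) *ₗ y ≈ᴹ 0ᴹ
    c₁y≈0 = ≈ᴹ-trans (*ₗ-cong c₁≡0 ≈ᴹ-refl) (*ₗ-zeroˡ y)

    cx≈0 : c zero *ₗ x +ᴹ 0ᴹ ≈ᴹ 0ᴹ
    cx≈0 = begin
      c zero *ₗ x +ᴹ 0ᴹ                            ≈⟨ +ᴹ-congˡ (+ᴹ-identityʳ 0ᴹ) ⟨
      c zero *ₗ x +ᴹ (0ᴹ +ᴹ 0ᴹ)                    ≈⟨ +ᴹ-congˡ (+ᴹ-congʳ c₁y≈0) ⟨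
      c zero *ₗ x +ᴹ (c (suc zero) *ₗ y +ᴹ 0ᴹ)     ≈⟨ e ⟩
      0ᴹ                                           ∎
      where open SetoidReasoning ≈ᴹ-setoid

  record IsSubspace (K : Pred Carrierᴹ 0ℓ) : Set where
    field
      resp     : ∀ {x y} → x ≈ᴹ y → K x → K y
      0-closed : K 0ᴹ
      +-closed : ∀ {x y} → K x → K y → K (x +ᴹ y)

    *-closed : ∀ c {x} → K x → K (c *ₗ x)
    *-closed c {x} Kx = scalar-induction (λ c → K (c *ₗ x))
      (resp (≈ᴹ-sym (*ₗ-zeroˡ x)) 0-closed)
      (λ {d} Kdx → resp (≈ᴹ-trans (+ᴹ-congʳ (≈ᴹ-sym (*ₗ-identityˡ x))) (≈ᴹ-sym (*ₗ-distribʳ x 1# d)))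
        (+-closed Kx Kdx))
      c

  open IsSubspace public

  ∩-isSubspace : ∀ {K L} → IsSubspace K → IsSubspace L → IsSubspace (K ∩ L)
  ∩-isSubspace K L = record
    { resp     = λ e (k , l) → resp K e k , resp L e l
    ; 0-closed = 0-closed K , 0-closed L
    ; +-closed = λ (k , l) (k′ , l′) → +-closed K k k′ , +-closed L l l′ }

  All-isSubspace : ∀ {I : Set} {L : I → Pred Carrierᴹ 0ℓ} → (∀ i → IsSubspace (L i)) →
                   ∀ is → IsSubspace (λ x → All (λ i → L i x) is)
  All-isSubspace L is = record
    { resp     = λ e → All.map (λ {i} → resp (L i) e)
    ; 0-closed = All.tabulate (λ {i} _ → 0-closed (L i))
    ; +-closed = λ xs ys → All.zipWith (λ {i} (x , y) → +-closed (L i) x y) (xs , ys) }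

  -- Over a finite field this is infinite dimension, in a form stable under intersection with
  -- subspaces of codimension one; doubly negated since those subspaces need not be decidable.
  Large : Pred Carrierᴹ 0ℓ → Set
  Large K = ∀ W → ¬ ¬ (∃[ x ] x ∉ W × K x)

  -- For subspaces L ⊆ K this says that L has codimension at most one in K.
  Corank≤1 : Pred Carrierᴹ 0ℓ → Pred Carrierᴹ 0ℓ → Set
  Corank≤1 K L = ∀ {x y} → K x → K y →
    ¬ ((∀ i → i ≢ 0# → ¬ L (i *ₗ x)) × (∀ i → ¬ L (y +ᴹ i *ₗ x)))

  large-⊆ : ∀ {K L} → K ⊆ L → Large K → Large L
  large-⊆ K⊆L large W none = large W λ (x , x∉ , Kx) → none (x , x∉ , K⊆L Kx)

  U-isSubspace : IsSubspace U
  U-isSubspace = record { resp = λ _ _ → tt ; 0-closed = tt ; +-closed = λ _ _ → tt }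

  -- Choose `x` in K off all scalar multiples of points of W, then `y` in K off all points w - ix.
  -- Then ix for i ≠ 0 and y + ix all lie in K outside W, and the corank bound forbids that none of
  -- them lies in L.
  large-∩ : ∀ {K L} → IsSubspace K → Large K → Corank≤1 K L → Large (K ∩ L)
  large-∩ {K} {L} sub large corank W none =
    large (cartesianProductWith _*ₗ_ (allFin p) W) λ (x , x∉ , Kx) →
    large (cartesianProductWith (λ i w → w +ᴹ -ᴹ (i *ₗ x)) (allFin p) W) λ (y , y∉ , Ky) →
    corank Kx Ky
      ( (λ i i≢0 Lix → none (i *ₗ x , x∉ ∘ scale i≢0 , *-closed sub i Kx , Lix))
      , (λ i Lyix → none (y +ᴹ i *ₗ x , y∉ ∘ translate i , +-closed sub Ky (*-closed sub i Kx) , Lyix)))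
    where
    open SetoidReasoning ≈ᴹ-setoid

    scale : ∀ {i x} → i ≢ 0# → i *ₗ x ∈ W → x ∈ cartesianProductWith _*ₗ_ (allFin p) W
    scale {i} {x} i≢0 ix∈W = let r , ri≡1 = inverse i≢0 in
      ∈-resp-≈ ≈ᴹ-setoid (begin
        r *ₗ i *ₗ x   ≈⟨ *ₗ-assoc r i x ⟨
        (r * i) *ₗ x  ≈⟨ *ₗ-cong ri≡1 ≈ᴹ-refl ⟩
        1# *ₗ x       ≈⟨ *ₗ-identityˡ x ⟩
        x             ∎)
      (∈-cartesianProductWith⁺ (setoid _) ≈ᴹ-setoid ≈ᴹ-setoid *ₗ-cong (∈-allFin r) ix∈W)

    translate : ∀ i {x y} → y +ᴹ i *ₗ x ∈ W →
                y ∈ cartesianProductWith (λ i w → w +ᴹ -ᴹ (i *ₗ x)) (allFin p) W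
    translate i {x} {y} y+ix∈W = ∈-resp-≈ ≈ᴹ-setoid (//-rightDividesʳ (i *ₗ x) y)
      (∈-cartesianProductWith⁺ (setoid _) ≈ᴹ-setoid ≈ᴹ-setoid
        (λ i≡j w≈w′ → +ᴹ-cong w≈w′ (-ᴹ‿cong (*ₗ-cong i≡j ≈ᴹ-refl))) (∈-allFin i) y+ix∈W)

  -- One condition is imposed at a time: the corank bounds of the remaining `L j` pass from K to the
  -- smaller space K ∩ `L i`.
  large-All : ∀ {I : Set} {K} {L : I → Pred Carrierᴹ 0ℓ} → IsSubspace K → Large K →
              (∀ i → IsSubspace (L i)) → (∀ i → Corank≤1 K (L i)) →
              ∀ is → Large (K ∩ λ x → All (λ i → L i x) is)
  large-All subK largeK subL corank [] W none =
    largeK W λ (x , x∉ , Kx) → none (x , x∉ , Kx , [])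
  large-All subK largeK subL corank (i ∷ is) W none =
    large-All (∩-isSubspace subK (subL i)) (large-∩ subK largeK (corank i)) subL
      (λ j (Kx , _) (Ky , _) → corank j Kx Ky) is W
      λ (x , x∉ , (Kx , Lx) , Lsx) → none (x , x∉ , Kx , Lx ∷ Lsx)

  -- Linear isomorphisms and their inverses.

  isIsomorphism : ∀ {f : Carrierᴹ → Carrierᴹ} → (∀ {x y} → x ≈ᴹ y → f x ≈ᴹ f y) →
                  (∀ x y → f (x +ᴹ y) ≈ᴹ f x +ᴹ f y) →
                  (∀ c x → f (c *ₗ x) ≈ᴹ c *ₗ f x) →
                  ∀ {g : Carrierᴹ → Carrierᴹ} → (∀ {x y} → x ≈ᴹ y → g x ≈ᴹ g y) →
                  (∀ x → f (g x) ≈ᴹ x) → (∀ x → g (f x) ≈ᴹ x) →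
                  IsLeftModuleIsomorphism rawLeftModule rawLeftModule f
  isIsomorphism {f} f-cong f-+ f-* {g} g-cong fg gf = record
    { isLeftModuleMonomorphism = record
      { isLeftModuleHomomorphism = record
        { +ᴹ-isGroupHomomorphism = record
          { isMonoidHomomorphism = record
            { isMagmaHomomorphism = record
              { isRelHomomorphism = record { cong = f-cong }
              ; homo = f-+ }
            ; ε-homo = f-0 }
          ; ⁻¹-homo = λ x → inverseˡ-uniqueᴹ (f (-ᴹ x)) (f x)
              (≈ᴹ-trans (≈ᴹ-sym (f-+ (-ᴹ x) x)) (≈ᴹ-trans (f-cong (-ᴹ‿inverseˡ x)) f-0)) }
        ; *ₗ-homo = f-* }
      ; injective = λ {x} {y} fx≈fy → ≈ᴹ-trans (≈ᴹ-sym (gf x)) (≈ᴹ-trans (g-cong fx≈fy) (gf y)) }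
    ; surjective = λ y → g y , λ z≈gy → ≈ᴹ-trans (f-cong z≈gy) (fg y) }
    where
    f-0 : f 0ᴹ ≈ᴹ 0ᴹ
    f-0 = ≈ᴹ-trans (f-cong (≈ᴹ-sym (*ₗ-zeroˡ 0ᴹ))) (≈ᴹ-trans (f-* 0# 0ᴹ) (*ₗ-zeroˡ (f 0ᴹ)))

  module _ {f : Carrierᴹ → Carrierᴹ} (f-iso : IsLeftModuleIsomorphism rawLeftModule rawLeftModule f) where
    private module f = IsLeftModuleIsomorphism f-iso

    preimage : Carrierᴹ → Carrierᴹ
    preimage y = proj₁ (f.surjective y)

    f-preimage : ∀ y → f (preimage y) ≈ᴹ y
    f-preimage y = proj₂ (f.surjective y) ≈ᴹ-refl

    -- Each law is verified after applying the injective map `f` to both sides.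
    preimage-isIsomorphism : IsLeftModuleIsomorphism rawLeftModule rawLeftModule preimage
    preimage-isIsomorphism = isIsomorphism
      (λ {x} {y} x≈y → f.injective (≈ᴹ-trans (f-preimage x) (≈ᴹ-trans x≈y (≈ᴹ-sym (f-preimage y)))))
      (λ x y → f.injective (≈ᴹ-trans (f-preimage (x +ᴹ y))
        (≈ᴹ-sym (≈ᴹ-trans (f.+ᴹ-homo _ _) (+ᴹ-cong (f-preimage x) (f-preimage y))))))
      (λ c x → f.injective (≈ᴹ-trans (f-preimage (c *ₗ x))
        (≈ᴹ-sym (≈ᴹ-trans (f.*ₗ-homo c _) (*ₗ-cong refl (f-preimage x))))))
      f.⟦⟧-cong
      (λ x → f.injective (f-preimage (f x))) f-preimage

  -- Kernels of functionals and transvections.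

  module _ {φ : Carrierᴹ → Fin p} (φ-linear : Functional φ) where
    private module φ = IsLeftModuleHomomorphism φ-linear

    Kernel : Pred Carrierᴹ 0ℓ
    Kernel x = φ x ≡ 0#

    kernel-isSubspace : IsSubspace Kernel
    kernel-isSubspace = record
      { resp     = λ x≈y φx≡0 → trans (sym (φ.⟦⟧-cong x≈y)) φx≡0
      ; 0-closed = φ.0ᴹ-homo
      ; +-closed = λ {x} {y} φx≡0 φy≡0 →
          trans (φ.+ᴹ-homo x y) (trans (cong₂ _+_ φx≡0 φy≡0) (+-identityˡ 0#)) }

    -- If φ x = 0, the multiple 1x is in the kernel; otherwise y + zx is, for z = -φ(y)/φ(x).
    kernel-corank : ∀ {K} → Corank≤1 K Kernel
    kernel-corank {x = x} {y} _ _ (none₁ , none₂) with φ x ≟ 0#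
    ... | yes φx≡0 = none₁ 1# 1≢0 (*-closed kernel-isSubspace 1# φx≡0)
    ... | no  φx≢0 = let z , zφx≡-φy = *-solve φx≢0 (- φ y) in none₂ z (begin
      φ (y +ᴹ z *ₗ x)    ≡⟨ φ.+ᴹ-homo y (z *ₗ x) ⟩
      φ y + φ (z *ₗ x)   ≡⟨ cong (φ y +_) (φ.*ₗ-homo z x) ⟩
      φ y + z * φ x      ≡⟨ cong (φ y +_) zφx≡-φy ⟩
      φ y + - φ y        ≡⟨ -‿inverseʳ (φ y) ⟩
      0#                 ∎)
      where open ≡-Reasoning

    transvect : Carrierᴹ → Carrierᴹ → Carrierᴹ
    transvect a x = x +ᴹ φ x *ₗ a

    transvect-cong : ∀ a {x y} → x ≈ᴹ y → transvect a x ≈ᴹ transvect a y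
    transvect-cong a x≈y = +ᴹ-cong x≈y (*ₗ-cong (φ.⟦⟧-cong x≈y) ≈ᴹ-refl)

    φ-transvect : ∀ {a} → Kernel a → ∀ x → φ (transvect a x) ≡ φ x
    φ-transvect {a} φa≡0 x = begin
      φ (x +ᴹ φ x *ₗ a)     ≡⟨ φ.+ᴹ-homo x _ ⟩
      φ x + φ (φ x *ₗ a)    ≡⟨ cong (φ x +_) (*-closed kernel-isSubspace (φ x) φa≡0) ⟩
      φ x + 0#              ≡⟨ +-identityʳ (φ x) ⟩
      φ x                   ∎
      where open ≡-Reasoning

    -- The first map leaves φ unchanged, so the displacements add up to φ(x)(b + a). The form b + a
    -- = 0 covers both orders of composing the maps along a vector and its negative.
    transvect-inverse : ∀ {a b} → Kernel b → b +ᴹ a ≈ᴹ 0ᴹ → ∀ x → transvect a (transvect b x) ≈ᴹ x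
    transvect-inverse {a} {b} φb≡0 b+a≈0 x = begin
      transvect b x +ᴹ φ (transvect b x) *ₗ a  ≈⟨ +ᴹ-congˡ (*ₗ-cong (φ-transvect φb≡0 x) ≈ᴹ-refl) ⟩
      (x +ᴹ φ x *ₗ b) +ᴹ φ x *ₗ a              ≈⟨ +ᴹ-assoc x _ _ ⟩
      x +ᴹ (φ x *ₗ b +ᴹ φ x *ₗ a)              ≈⟨ +ᴹ-congˡ (*ₗ-distribˡ (φ x) b a) ⟨
      x +ᴹ φ x *ₗ (b +ᴹ a)                     ≈⟨ +ᴹ-congˡ (*ₗ-cong refl b+a≈0) ⟩
      x +ᴹ φ x *ₗ 0ᴹ                           ≈⟨ +ᴹ-congˡ (*ₗ-zeroʳ (φ x)) ⟩
      x +ᴹ 0ᴹ                                  ≈⟨ +ᴹ-identityʳ x ⟩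
      x                                        ∎
      where open SetoidReasoning ≈ᴹ-setoid

    transvect-+ : ∀ a x y → transvect a (x +ᴹ y) ≈ᴹ transvect a x +ᴹ transvect a y
    transvect-+ a x y = begin
      (x +ᴹ y) +ᴹ φ (x +ᴹ y) *ₗ a               ≈⟨ +ᴹ-congˡ (*ₗ-cong (φ.+ᴹ-homo x y) ≈ᴹ-refl) ⟩
      (x +ᴹ y) +ᴹ (φ x + φ y) *ₗ a              ≈⟨ +ᴹ-congˡ (*ₗ-distribʳ a (φ x) (φ y)) ⟩
      (x +ᴹ y) +ᴹ (φ x *ₗ a +ᴹ φ y *ₗ a)        ≈⟨ interchange x y _ _ ⟩
      transvect a x +ᴹ transvect a y            ∎
      where open SetoidReasoning ≈ᴹ-setoid

    transvect-* : ∀ a c x → transvect a (c *ₗ x) ≈ᴹ c *ₗ transvect a x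
    transvect-* a c x = begin
      c *ₗ x +ᴹ φ (c *ₗ x) *ₗ a       ≈⟨ +ᴹ-congˡ (*ₗ-cong (φ.*ₗ-homo c x) ≈ᴹ-refl) ⟩
      c *ₗ x +ᴹ (c * φ x) *ₗ a        ≈⟨ +ᴹ-congˡ (*ₗ-assoc c (φ x) a) ⟩
      c *ₗ x +ᴹ c *ₗ φ x *ₗ a         ≈⟨ *ₗ-distribˡ c x _ ⟨
      c *ₗ transvect a x              ∎
      where open SetoidReasoning ≈ᴹ-setoid

    -a∈Kernel : ∀ {a} → Kernel a → Kernel (-ᴹ a)
    -a∈Kernel {a} φa≡0 = trans (φ.-ᴹ-homo a) (trans (cong -_ φa≡0) -0≡0)

    transvect-isIsomorphism : ∀ {a} → Kernel a → IsLeftModuleIsomorphism rawLeftModule rawLeftModule (transvect a)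
    transvect-isIsomorphism {a} φa≡0 =
      isIsomorphism (transvect-cong a) (transvect-+ a) (transvect-* a)
        {transvect (-ᴹ a)} (transvect-cong (-ᴹ a))
        (transvect-inverse -φa≡0 (-ᴹ‿inverseˡ a)) (transvect-inverse φa≡0 (-ᴹ‿inverseʳ a))
      where
      -φa≡0 : Kernel (-ᴹ a)
      -φa≡0 = -a∈Kernel φa≡0

-- Automorphisms of the polar geometry and their action on sets.

module Geometry {p : ℕ} .{{_ : NonZero p}} (p-prime : Prime p) (G : PolarGeometry p) where
  open PolarGeometry G
  open ZFA G hiding (_⊆_)
  open PrimeField p p-prime
  open Automorphism
  module L  = SpaceOver p-prime V
  module L* = SpaceOver p-prime V*
  module Φˡ w = IsLeftModuleHomomorphism (linearˡ w)
  module Φʳ v = IsLeftModuleHomomorphism (linearʳ v)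

  idᴬ : Automorphism
  idᴬ = record
    { onV = λ v → v ; onV* = λ w → w
    ; isoV  = Identity.isLeftModuleIsomorphism _ V.≈ᴹ-refl
    ; isoV* = Identity.isLeftModuleIsomorphism _ V*.≈ᴹ-refl
    ; preserves-Φ = λ _ _ → refl }

  infixr 9 _∘ᴬ_
  _∘ᴬ_ : Automorphism → Automorphism → Automorphism
  σ ∘ᴬ ρ = record
    { onV = onV σ ∘ onV ρ ; onV* = onV* σ ∘ onV* ρ
    ; isoV  = Composition.isLeftModuleIsomorphism V.≈ᴹ-trans (isoV ρ) (isoV σ)
    ; isoV* = Composition.isLeftModuleIsomorphism V*.≈ᴹ-trans (isoV* ρ) (isoV* σ)
    ; preserves-Φ = λ v w → trans (preserves-Φ σ _ _) (preserves-Φ ρ v w) }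

  onV-cong : ∀ σ {v v′} → v V.≈ᴹ v′ → onV σ v V.≈ᴹ onV σ v′
  onV-cong σ = IsLeftModuleIsomorphism.⟦⟧-cong (isoV σ)

  onV*-cong : ∀ σ {w w′} → w V*.≈ᴹ w′ → onV* σ w V*.≈ᴹ onV* σ w′
  onV*-cong σ = IsLeftModuleIsomorphism.⟦⟧-cong (isoV* σ)

  Φ-cong : ∀ {v v′ w w′} → v V.≈ᴹ v′ → w V*.≈ᴹ w′ → Φ v w ≡ Φ v′ w′
  Φ-cong {v′ = v′} {w} v≈v′ w≈w′ = trans (Φˡ.⟦⟧-cong w v≈v′) (Φʳ.⟦⟧-cong v′ w≈w′)

  _⁻¹ᴬ : Automorphism → Automorphism
  σ ⁻¹ᴬ = record
    { onV = L.preimage (isoV σ) ; onV* = L*.preimage (isoV* σ)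
    ; isoV  = L.preimage-isIsomorphism (isoV σ)
    ; isoV* = L*.preimage-isIsomorphism (isoV* σ)
    ; preserves-Φ = λ v w → trans (sym (preserves-Φ σ _ _))
        (Φ-cong (L.f-preimage (isoV σ) v) (L*.f-preimage (isoV* σ) w)) }

  -- On V* it acts by w ↦ w - Φ(a,w)b, the coefficient being written Φ(-a,w) so that `transvect`
  -- applies. The two corrections to Φ(v,w) cancel, and the mixed one contains the factor Φ(a,b) =
  -- 0.
  transvection : ∀ a b → Φ a b ≡ 0# → Automorphism
  transvection a b Φab≡0 = record
    { onV = L.transvect (linearˡ b) a ; onV* = L*.transvect (linearʳ (V.-ᴹ a)) b
    ; isoV  = L.transvect-isIsomorphism (linearˡ b) Φab≡0
    ; isoV* = L*.transvect-isIsomorphism (linearʳ (V.-ᴹ a)) (L.-a∈Kernel (linearˡ b) Φab≡0)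
    ; preserves-Φ = pres }
    where
    open ≡-Reasoning
    pres : ∀ v w → Φ (v V.+ᴹ Φ v b V.*ₗ a) (w V*.+ᴹ Φ (V.-ᴹ a) w V*.*ₗ b) ≡ Φ v w
    pres v w = begin
      Φ (v V.+ᴹ Φ v b V.*ₗ a) w′                       ≡⟨ Φˡ.+ᴹ-homo w′ v _ ⟩
      Φ v w′ + Φ (Φ v b V.*ₗ a) w′                     ≡⟨ cong₂ _+_ (Φʳ.+ᴹ-homo v w _) (Φˡ.*ₗ-homo w′ _ a) ⟩
      (Φ v w + Φ v (s V*.*ₗ b)) + Φ v b * Φ a w′       ≡⟨ cong₂ _+_ (cong (Φ v w +_) (Φʳ.*ₗ-homo v s b))
                                                                    (cong (Φ v b *_) Φaw′) ⟩
      (Φ v w + s * Φ v b) + Φ v b * Φ a w              ≡⟨ +-assoc _ _ _ ⟩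
      Φ v w + (s * Φ v b + Φ v b * Φ a w)              ≡⟨ cong (λ t → Φ v w + (t + Φ v b * Φ a w)) (*-comm s _) ⟩
      Φ v w + (Φ v b * s + Φ v b * Φ a w)              ≡⟨ cong (Φ v w +_) (distribˡ (Φ v b) s (Φ a w)) ⟨
      Φ v w + Φ v b * (s + Φ a w)                      ≡⟨ cong (λ t → Φ v w + Φ v b * (t + Φ a w)) (Φˡ.-ᴹ-homo w a) ⟩
      Φ v w + Φ v b * (- Φ a w + Φ a w)                ≡⟨ cong (λ t → Φ v w + Φ v b * t) (-‿inverseˡ (Φ a w)) ⟩
      Φ v w + Φ v b * 0#                               ≡⟨ cong (Φ v w +_) (zeroʳ (Φ v b)) ⟩
      Φ v w + 0#                                       ≡⟨ +-identityʳ _ ⟩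
      Φ v w                                            ∎
      where
      s : Fin p
      s = Φ (V.-ᴹ a) w
      w′ : V*.Carrierᴹ
      w′ = w V*.+ᴹ s V*.*ₗ b
      Φaw′ : Φ a w′ ≡ Φ a w
      Φaw′ = begin
        Φ a w′                     ≡⟨ Φʳ.+ᴹ-homo a w _ ⟩
        Φ a w + Φ a (s V*.*ₗ b)    ≡⟨ cong (Φ a w +_) (L*.*-closed (L*.kernel-isSubspace (linearʳ a)) s Φab≡0) ⟩
        Φ a w + 0#                 ≡⟨ +-identityʳ _ ⟩
        Φ a w                      ∎

  Φ-translate : ∀ {a b} → Φ a b ≡ 0# → ∀ v c → Φ (v V.+ᴹ c V.*ₗ a) b ≡ Φ v b
  Φ-translate {a} {b} Φab≡0 v c = begin
    Φ (v V.+ᴹ c V.*ₗ a) b      ≡⟨ Φˡ.+ᴹ-homo b v _ ⟩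
    Φ v b + Φ (c V.*ₗ a) b     ≡⟨ cong (Φ v b +_) (L.*-closed (L.kernel-isSubspace (linearˡ b)) c Φab≡0) ⟩
    Φ v b + 0#                 ≡⟨ +-identityʳ _ ⟩
    Φ v b                      ∎
    where open ≡-Reasoning

  -- Atoms of the other sort go to zero, where orthogonality is automatic, so a mixed support can be
  -- handled as a single list.
  vectorPart : Atom → V.Carrierᴹ
  vectorPart = [ (λ v → v) , (λ _ → V.0ᴹ) ]′

  covectorPart : Atom → V*.Carrierᴹ
  covectorPart = [ (λ _ → V*.0ᴹ) , (λ w → w) ]′

  -- A vector v is displaced by Φ(v,b)a and a covector w by Φ(-a,w)b; orthogonality makes both zero.
  transvection-fixes : ∀ {a b} (Φab≡0 : Φ a b ≡ 0#) {A} → All (λ c → Φ a (covectorPart c) ≡ 0#) A →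
                       All (λ c → Φ (vectorPart c) b ≡ 0#) A → Fixes (transvection a b Φab≡0) A
  transvection-fixes {a} {b} Φab≡0 ⊥a ⊥b = All.zipWith (λ { {c} (x , y) → fix c x y }) (⊥a , ⊥b)
    where
    fix : ∀ c → Φ a (covectorPart c) ≡ 0# → Φ (vectorPart c) b ≡ 0# → onAtom (transvection a b Φab≡0) c ≈ᴬ c
    fix (inj₁ v) _ Φvb≡0 = inj₁ (V.≈ᴹ-trans (V.+ᴹ-congˡ (V.≈ᴹ-trans (V.*ₗ-cong Φvb≡0 V.≈ᴹ-refl) (V.*ₗ-zeroˡ a)))
                             (V.+ᴹ-identityʳ v))
    fix (inj₂ w) Φaw≡0 _ = inj₂ (V*.≈ᴹ-trans (V*.+ᴹ-congˡ
      (V*.≈ᴹ-trans (V*.*ₗ-cong (L.-a∈Kernel (linearˡ w) Φaw≡0) V*.≈ᴹ-refl) (V*.*ₗ-zeroˡ b))) (V*.+ᴹ-identityʳ w))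

  •-cong : ∀ σ {x y} → x ≈ y → σ • x ≈ σ • y
  •-cong σ {atom (inj₁ _)} {atom (inj₁ _)} (inj₁ e) = inj₁ (onV-cong σ e)
  •-cong σ {atom (inj₂ _)} {atom (inj₂ _)} (inj₂ e) = inj₂ (onV*-cong σ e)
  •-cong σ {set _ _} {set _ _} (f , g) =
    (λ i → let j , e = f i in j , •-cong σ e) , (λ j → let i , e = g j in i , •-cong σ e)

  -- The moved pair over `i` equals a pair over some `k` in the graph of `g`; `k` and `j` index the
  -- same element, so extensionality of `g` identifies their values.
  value-transport : ∀ {X} (f g : Function X) {σ} → σ • Function.asSet f ≈ Function.asSet g →
                    ∀ i j → σ • element X i ≈ element X j → Function.value f i ≡ Function.value g j
  value-transport {X} f g {σ} (to , _) i j e with to i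
  ... | k , q = trans
    (toℕ-injective (numeral-injective _ _
      (≈-trans (≈-sym (numeral-fixed σ (toℕ (Function.value f i)))) (pair-injective₂ σ {x} {y} {x′} {y′} q))))
    (Function.extensional g k j (≈-trans (≈-sym (pair-injective₁ σ {x} {y} {x′} {y′} q)) e))
    where
    x y x′ y′ : 𝕍
    x  = element X i
    y  = numeral (toℕ (Function.value f i))
    x′ = element X k
    y′ = numeral (toℕ (Function.value g k))

-- The orbit of a vector and functions on it.

module Orbit {p : ℕ} .{{_ : NonZero p}} (p-prime : Prime p) (G : PolarGeometry p)
             (v₀ : LeftModule.Carrierᴹ (PolarGeometry.V G)) where
  open PolarGeometry G
  open ZFA G hiding (_⊆_)
  open PrimeField p p-prime
  open Geometry p-prime G
  open Automorphism
  open Function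

  point : Automorphism → V.Carrierᴹ
  point σ = onV σ v₀

  -- Indexing by automorphisms gives each point many indices; a function on the orbit is thus a
  -- function of automorphisms depending only on `point`.
  orbit : 𝕍
  orbit = set Automorphism (λ σ → atom (inj₁ (point σ)))

  orbit-equivariant : Equivariant orbit
  orbit-equivariant σ =
    (λ ρ → σ ∘ᴬ ρ , inj₁ V.≈ᴹ-refl) ,
    (λ ρ → σ ⁻¹ᴬ ∘ᴬ ρ , inj₁ (L.f-preimage (isoV σ) (point ρ)))

  orbit-definable : Definable orbit
  orbit-definable = orbit-equivariant , 1 , (λ _ → idᴬ) , λ σ → zero , σ , inj₁ V.≈ᴹ-refl

  orbit-isZFASet : IsZFASet orbit
  orbit-isZFASet = tt , ([] , λ σ _ → orbit-equivariant σ) , λ _ → tt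

  -- The atom `w` is a support: an automorphism that fixes `w` and preserves Φ preserves Φ(·,w).
  pairing : V*.Carrierᴹ → Function orbit
  pairing w = function (λ ρ → Φ (point ρ) w)
    (λ { _ _ (inj₁ e) → Φˡ.⟦⟧-cong w e })
    (inj₂ w ∷ [] , λ { σ (inj₂ σw≈w ∷ []) → 
      graph-fixed orbit {σ = σ} (permutes orbit {σ} (orbit-equivariant σ)) λ { i j (inj₁ e) → trans (sym (preserves-Φ σ (point i) w)) (Φ-cong e σw≈w) } })

  module _ (S : FinitelySupported orbit) where
    value-linearCombination : ∀ {k} (c : Fin k → Fin p) (f : Fin k → Function orbit) ρ →
      value (linearCombination (functionSpace orbit S) c f) ρ ≡ sum (λ i → c i * value (f i) ρ)
    value-linearCombination {zero}  c f ρ = refl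
    value-linearCombination {suc k} c f ρ =
      cong (c zero * value (f zero) ρ +_) (value-linearCombination (c ∘ suc) (f ∘ suc) ρ)

  -- If Φ(v₀,b) = 0, take d with Φ(d,b) = 1. Then v₀ and d are independent, so some c has Φ(v₀,c) =
  -- 1 and Φ(d,c) = 0; the transvection along d by c sends v₀ to v₀ + d, whose pairing with b is 1.
  orbit-separates : ¬ v₀ V.≈ᴹ V.0ᴹ → ∀ {b} → ¬ b V*.≈ᴹ V*.0ᴹ → ∃[ ρ ] Φ (point ρ) b ≢ 0#
  orbit-separates v₀≉0 {b} b≉0 with Φ v₀ b ≟ 0#
  ... | no  Φv₀b≢0 = idᴬ , Φv₀b≢0
  ... | yes Φv₀b≡0 = transvection d c (dual (suc zero)) , λ e → 1≢0 (begin
      1#                                       ≡⟨ Φdb≡1 ⟨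
      Φ d b                                    ≡⟨ *-identityˡ _ ⟨
      1# * Φ d b                               ≡⟨ cong (_* Φ d b) (dual zero) ⟨
      Φ v₀ c * Φ d b                           ≡⟨ +-identityˡ _ ⟨
      0# + Φ v₀ c * Φ d b                      ≡⟨ cong₂ _+_ Φv₀b≡0 (Φˡ.*ₗ-homo b _ d) ⟨
      Φ v₀ b + Φ (Φ v₀ c V.*ₗ d) b             ≡⟨ Φˡ.+ᴹ-homo b v₀ _ ⟨
      Φ (v₀ V.+ᴹ Φ v₀ c V.*ₗ d) b              ≡⟨ e ⟩
      0#                                       ∎)
    where
    open ≡-Reasoning
    d-spec : ∃[ d ] _ × (∀ i → Φ d b ≡ 1#)
    d-spec = extend-V* {1} (λ _ → b) (L*.singleton-independent b≉0) (λ _ → 1#) []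
    d : V.Carrierᴹ
    d = proj₁ d-spec
    Φdb≡1 : Φ d b ≡ 1#
    Φdb≡1 = proj₂ (proj₂ d-spec) zero
    c-spec : ∃[ c ] _ × (∀ i → Φ ((v₀ Vector.∷ d Vector.∷ Vector.[]) i) c
                             ≡ (1# Vector.∷ 0# Vector.∷ Vector.[]) i)
    c-spec = extend-V _ (L.pair-independent (linearˡ b) v₀≉0 Φv₀b≡0 Φdb≡1)
      (1# Vector.∷ 0# Vector.∷ Vector.[]) []
    c : V*.Carrierᴹ
    c = proj₁ c-spec
    dual = proj₂ (proj₂ c-spec)

  -- Translates of functions by the transvections along a fixed vector.

  module Translation (a : V.Carrierᴹ) where

    -- g is f moved by τ_b; stated on indices, it makes sense for every b, not only for b ⊥ a.
    Translate : V*.Carrierᴹ → (f g : Automorphism → Fin p) → Set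
    Translate b f g = ∀ ρ ρ′ → point ρ′ V.≈ᴹ point ρ V.+ᴹ Φ (point ρ) b V.*ₗ a → f ρ ≡ g ρ′

    a⊥ : Pred V*.Carrierᴹ 0ℓ
    a⊥ b = Φ a b ≡ 0#

    a⊥-isSubspace : L*.IsSubspace a⊥
    a⊥-isSubspace = L*.kernel-isSubspace (linearʳ a)

    -- Adding multiples of `a` does not affect the pairing with `b′`, so τ_b followed by τ_b′ is
    -- τ_(b+b′).
    translate-+ : ∀ {b b′} → a⊥ b′ → ∀ {v v′ v″} →
                  v′ V.≈ᴹ v V.+ᴹ Φ v b V.*ₗ a → v″ V.≈ᴹ v V.+ᴹ Φ v (b V*.+ᴹ b′) V.*ₗ a →
                  v″ V.≈ᴹ v′ V.+ᴹ Φ v′ b′ V.*ₗ a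
    translate-+ {b} {b′} Φab′≡0 {v} {v′} {v″} e e″ = begin
      v″                                                 ≈⟨ e″ ⟩
      v V.+ᴹ Φ v (b V*.+ᴹ b′) V.*ₗ a                     ≈⟨ V.+ᴹ-congˡ (V.*ₗ-cong (Φʳ.+ᴹ-homo v b b′) V.≈ᴹ-refl) ⟩
      v V.+ᴹ (Φ v b + Φ v b′) V.*ₗ a                     ≈⟨ V.+ᴹ-congˡ (V.*ₗ-distribʳ a _ _) ⟩
      v V.+ᴹ (Φ v b V.*ₗ a V.+ᴹ Φ v b′ V.*ₗ a)           ≈⟨ V.+ᴹ-assoc v _ _ ⟨
      (v V.+ᴹ Φ v b V.*ₗ a) V.+ᴹ Φ v b′ V.*ₗ a           ≈⟨ V.+ᴹ-cong e (V.*ₗ-cong Φv′b′ V.≈ᴹ-refl) ⟨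
      v′ V.+ᴹ Φ v′ b′ V.*ₗ a                             ∎
      where
      open SetoidReasoning V.≈ᴹ-setoid
      Φv′b′ : Φ v′ b′ ≡ Φ v b′
      Φv′b′ = trans (Φˡ.⟦⟧-cong b′ e) (Φ-translate Φab′≡0 v (Φ v b))

    -- Equal pairings with v = `point ρ` give τ_b and τ_b′ the same preimage v - Φ(v,b)a of v, and
    -- both sides are the value of `f` there.
    translates-agree : ∀ {b b′ f g g′} → Translate b f g → Translate b′ f g′ → a⊥ b → a⊥ b′ →
                       ∀ ρ → Φ (point ρ) b ≡ Φ (point ρ) b′ → g ρ ≡ g′ ρ
    translates-agree {b} {b′} T T′ Φab≡0 Φab′≡0 ρ e =
      trans (sym (T ρ₁ ρ (back Φab≡0 refl))) (T′ ρ₁ ρ (back Φab′≡0 (sym e)))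
      where
      ρ₁ : Automorphism
      ρ₁ = transvection (V.-ᴹ a) b (L.-a∈Kernel (linearˡ b) Φab≡0) ∘ᴬ ρ

      back : ∀ {c} → a⊥ c → Φ (point ρ) c ≡ Φ (point ρ) b →
             point ρ V.≈ᴹ point ρ₁ V.+ᴹ Φ (point ρ₁) c V.*ₗ a
      back {c} Φac≡0 s = begin
        v
          ≈⟨ L.transvect-inverse (linearˡ b) (L.-a∈Kernel (linearˡ b) Φab≡0) (V.-ᴹ‿inverseˡ a) v ⟨
        point ρ₁ V.+ᴹ Φ (point ρ₁) b V.*ₗ a
          ≈⟨ V.+ᴹ-congˡ (V.*ₗ-cong (trans (same Φab≡0) (trans (sym s) (sym (same Φac≡0)))) V.≈ᴹ-refl) ⟩
        point ρ₁ V.+ᴹ Φ (point ρ₁) c V.*ₗ a ∎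
        where
        open SetoidReasoning V.≈ᴹ-setoid
        v : V.Carrierᴹ
        v = point ρ
        same : ∀ {c} → a⊥ c → Φ (point ρ₁) c ≡ Φ v c
        same {c} Φac≡0 = Φ-translate (L.-a∈Kernel (linearˡ c) Φac≡0) v _

    -- As τ_b is τ_c followed by τ_b′, the values of `f` at v and at τ_c v are those of `g` and `g′`
    -- at the common point τ_b v.
    translate-difference : ∀ {b b′ c f g g′} → Translate b f g → Translate b′ f g′ → (∀ ρ → g ρ ≡ g′ ρ) →
                           a⊥ b → a⊥ b′ → c V*.+ᴹ b′ V*.≈ᴹ b → Translate c f f
    translate-difference {b} T T′ g≗g′ Φab≡0 Φab′≡0 c+b′≈b ρ ρ′ e =
      trans (T ρ ρ₂ V.≈ᴹ-refl) (trans (g≗g′ ρ₂) (sym (T′ ρ′ ρ₂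
        (translate-+ Φab′≡0 e (V.+ᴹ-congˡ (V.*ₗ-cong (Φʳ.⟦⟧-cong (point ρ) (V*.≈ᴹ-sym c+b′≈b)) V.≈ᴹ-refl))))))
      where
      ρ₂ : Automorphism
      ρ₂ = transvection a b Φab≡0 ∘ᴬ ρ

    Stabilizer : Function orbit → Pred V*.Carrierᴹ 0ℓ
    Stabilizer f b = a⊥ b × Translate b (value f) (value f)

    stabilizer-isSubspace : ∀ f → L*.IsSubspace (Stabilizer f)
    stabilizer-isSubspace f = record
      { resp = λ b≈b′ (Φab≡0 , T) → L*.resp a⊥-isSubspace b≈b′ Φab≡0 , λ ρ ρ′ e → T ρ ρ′
          (V.≈ᴹ-trans e (V.+ᴹ-congˡ (V.*ₗ-cong (Φʳ.⟦⟧-cong _ (V*.≈ᴹ-sym b≈b′)) V.≈ᴹ-refl)))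
      ; 0-closed = L*.0-closed a⊥-isSubspace , λ ρ ρ′ e → extensional f ρ ρ′ (inj₁ (V.≈ᴹ-sym
          (V.≈ᴹ-trans e (V.≈ᴹ-trans (V.+ᴹ-congˡ
            (V.≈ᴹ-trans (V.*ₗ-cong (Φʳ.0ᴹ-homo (point ρ)) V.≈ᴹ-refl) (V.*ₗ-zeroˡ a))) (V.+ᴹ-identityʳ _)))))
      ; +-closed = λ {b} {b′} (Φab≡0 , T) (Φab′≡0 , T′) → L*.+-closed a⊥-isSubspace Φab≡0 Φab′≡0 ,
          λ ρ ρ′ e → let ρ₁ = transvection a b Φab≡0 ∘ᴬ ρ in
            trans (T ρ ρ₁ V.≈ᴹ-refl) (T′ ρ₁ ρ′ (translate-+ Φab′≡0 V.≈ᴹ-refl e)) }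

    -- Fix v = `point ρ`. If Φ(v,x) = 0, the terms of each sum do not depend on i, and p equal terms
    -- add up to zero. Otherwise Φ(v,y) = cΦ(v,x) for some c, so y + ix and (c + i)x pair equally
    -- with v and the second family is a shift of the first.
    translates-sum : ∀ {f} {g h : Fin p → Automorphism → Fin p} {x y} → a⊥ x → a⊥ y →
                     (∀ i → Translate (i V*.*ₗ x) f (g i)) → (∀ i → Translate (y V*.+ᴹ i V*.*ₗ x) f (h i)) →
                     ∀ ρ → sum (λ i → 1# * g i ρ) + sum (λ i → - 1# * h i ρ) ≡ 0#
    translates-sum {f} {g} {h} {x} {y} x⊥ y⊥ Tg Th ρ with Φ (point ρ) x ≟ 0#
    ... | yes Φvx≡0 = trans
            (cong₂ _+_ (sum-const≡0 λ i → cong (1# *_) (g-const i)) (sum-const≡0 λ i → cong (- 1# *_) (h-const i)))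
            (+-identityˡ 0#)
      where
      v : V.Carrierᴹ
      v = point ρ
      ix⊥ : ∀ i → a⊥ (i V*.*ₗ x)
      ix⊥ i = L*.*-closed a⊥-isSubspace i x⊥
      y+ix⊥ : ∀ i → a⊥ (y V*.+ᴹ i V*.*ₗ x)
      y+ix⊥ i = L*.+-closed a⊥-isSubspace y⊥ (ix⊥ i)
      Φv-ix : ∀ i → Φ v (i V*.*ₗ x) ≡ 0#
      Φv-ix i = L*.*-closed (L*.kernel-isSubspace (linearʳ v)) i Φvx≡0
      Φv-ix-const : ∀ i → Φ v (i V*.*ₗ x) ≡ Φ v (0# V*.*ₗ x)
      Φv-ix-const i = trans (Φv-ix i) (sym (Φv-ix 0#))
      g-const : ∀ i → g i ρ ≡ g 0# ρ
      g-const i = translates-agree {f = f} {g i} {g 0#} (Tg i) (Tg 0#) (ix⊥ i) (ix⊥ 0#) ρ (Φv-ix-const i)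
      h-const : ∀ i → h i ρ ≡ h 0# ρ
      h-const i = translates-agree {f = f} {h i} {h 0#} (Th i) (Th 0#) (y+ix⊥ i) (y+ix⊥ 0#) ρ
        (trans (Φʳ.+ᴹ-homo v y _) (trans (cong (Φ v y +_) (Φv-ix-const i)) (sym (Φʳ.+ᴹ-homo v y _))))
    ... | no Φvx≢0 = let c , cΦvx≡Φvy = *-solve Φvx≢0 (Φ v y) in
            sum-difference {λ i → g i ρ} {λ i → h i ρ} c λ i →
              translates-agree {f = f} {h i} {g (c + i)} (Th i) (Tg (c + i))
              (L*.+-closed a⊥-isSubspace y⊥ (L*.*-closed a⊥-isSubspace i x⊥))
              (L*.*-closed a⊥-isSubspace (c + i) x⊥) ρ (begin
                Φ v (y V*.+ᴹ i V*.*ₗ x)       ≡⟨ Φʳ.+ᴹ-homo v y _ ⟩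
                Φ v y + Φ v (i V*.*ₗ x)       ≡⟨ cong₂ _+_ (sym cΦvx≡Φvy) (Φʳ.*ₗ-homo v i x) ⟩
                c * Φ v x + i * Φ v x         ≡⟨ distribʳ (Φ v x) c i ⟨
                (c + i) * Φ v x               ≡⟨ Φʳ.*ₗ-homo v (c + i) x ⟨
                Φ v ((c + i) V*.*ₗ x)         ∎)
      where
      open ≡-Reasoning
      v : V.Carrierᴹ
      v = point ρ

    covector : V*.Carrierᴹ → V*.Carrierᴹ → Fin p ⊎ Fin p → V*.Carrierᴹ
    covector x y (inj₁ i) = i V*.*ₗ x
    covector x y (inj₂ i) = y V*.+ᴹ i V*.*ₗ x

    covector-closed : ∀ {K} → L*.IsSubspace K → ∀ {x y} → K x → K y → ∀ k → K (covector x y k)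
    covector-closed K Kx Ky (inj₁ i) = L*.*-closed K i Kx
    covector-closed K Kx Ky (inj₂ i) = L*.+-closed K Ky (L*.*-closed K i Kx)

    -- The family is a parameter because unfolding its definition makes type checking infeasible.
    module Dependence (S : FinitelySupported orbit) (f : Function orbit) {x y : V*.Carrierᴹ}
                      (Φax≡0 : a⊥ x) (Φay≡0 : a⊥ y) (family : Fin p ⊎ Fin p → Function orbit)
                      (family-translate : ∀ k → Translate (covector x y k) (value f) (value (family k)))
                      (none₁ : ∀ i → i ≢ 0# → ¬ Stabilizer f (i V*.*ₗ x))
                      (none₂ : ∀ i → ¬ Stabilizer f (y V*.+ᴹ i V*.*ₗ x)) where
      private module FS = LeftModule (functionSpace orbit S)

      sign : Fin p ⊎ Fin p → Fin p
      sign = [ (λ _ → 1#) , (λ _ → - 1#) ]′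

      difference-stabilizes : ∀ k l {c} → family k FS.≈ᴹ family l → a⊥ c →
                              c V*.+ᴹ covector x y l V*.≈ᴹ covector x y k → Stabilizer f c
      difference-stabilizes k l e Φac≡0 c+l≈k = Φac≡0 ,
        translate-difference {f = value f} {value (family k)} {value (family l)}
          (family-translate k) (family-translate l) e
          (covector-closed a⊥-isSubspace Φax≡0 Φay≡0 k) (covector-closed a⊥-isSubspace Φax≡0 Φay≡0 l) c+l≈k

      i-j+j : ∀ i j → (i + - j) V*.*ₗ x V*.+ᴹ j V*.*ₗ x V*.≈ᴹ i V*.*ₗ x
      i-j+j i j = V*.≈ᴹ-trans (V*.≈ᴹ-sym (V*.*ₗ-distribʳ x _ j)) (V*.*ₗ-cong (x-y+y≡x j i) V*.≈ᴹ-refl)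

      i-jx⊥ : ∀ i j → a⊥ ((i + - j) V*.*ₗ x)
      i-jx⊥ i j = L*.*-closed a⊥-isSubspace _ Φax≡0

      inj₁≉inj₂ : ∀ i j → ¬ family (inj₂ i) FS.≈ᴹ family (inj₁ j)
      inj₁≉inj₂ i j e = none₂ (i + - j) (difference-stabilizes (inj₂ i) (inj₁ j) e
        (L*.+-closed a⊥-isSubspace Φay≡0 (i-jx⊥ i j))
        (V*.≈ᴹ-trans (V*.+ᴹ-assoc y _ _) (V*.+ᴹ-congˡ (i-j+j i j))))

      -- A coincidence inside one half puts (i - j)x with i ≠ j into the stabilizer, against
      -- `none₁`; one between the halves puts y + (i - j)x there, against `none₂`.
      family-injective : ∀ k l → family k FS.≈ᴹ family l → k ≡ l
      family-injective (inj₁ i) (inj₁ j) e with i ≟ j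
      ... | yes i≡j = cong inj₁ i≡j
      ... | no  i≢j = ⊥-elim (none₁ (i + - j) (i≢j ∘ x-y≡0⇒x≡y i j)
                        (difference-stabilizes (inj₁ i) (inj₁ j) e (i-jx⊥ i j) (i-j+j i j)))
      family-injective (inj₂ i) (inj₂ j) e with i ≟ j
      ... | yes i≡j = cong inj₂ i≡j
      ... | no  i≢j = ⊥-elim (none₁ (i + - j) (i≢j ∘ x-y≡0⇒x≡y i j)
                        (difference-stabilizes (inj₂ i) (inj₂ j) e (i-jx⊥ i j)
                          (V*.≈ᴹ-trans (L*.x∙yz≈y∙xz _ y _) (V*.+ᴹ-congˡ (i-j+j i j)))))
      family-injective (inj₂ i) (inj₁ j) e = ⊥-elim (inj₁≉inj₂ i j e)
      family-injective (inj₁ i) (inj₂ j) e = ⊥-elim (inj₁≉inj₂ j i (λ ρ → sym (e ρ)))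

      splitFamily-injective : ∀ {k l} → family (splitAt p k) FS.≈ᴹ family (splitAt p l) → k ≡ l
      splitFamily-injective {k} {l} e = trans (sym (join-splitAt p p k))
        (trans (cong (join p p) (family-injective (splitAt p k) (splitAt p l) e)) (join-splitAt p p l))

      dependence : linearCombination (functionSpace orbit S) (sign ∘ splitAt p) (family ∘ splitAt p)
                   FS.≈ᴹ FS.0ᴹ
      dependence ρ = begin
        value (linearCombination (functionSpace orbit S) (sign ∘ splitAt p) (family ∘ splitAt p)) ρ
          ≡⟨ value-linearCombination S (sign ∘ splitAt p) (family ∘ splitAt p) ρ ⟩
        sum (term ∘ splitAt p)
          ≡⟨ sum-↑ +-commutativeMonoid p (term ∘ splitAt p) ⟩
        sum (λ i → term (splitAt p (i ↑ˡ p))) + sum (λ i → term (splitAt p (p ↑ʳ i)))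
          ≡⟨ cong₂ _+_ (sum-cong-≗ λ i → cong term (splitAt-↑ˡ p i p))
                       (sum-cong-≗ λ i → cong term (splitAt-↑ʳ p p i)) ⟩
        sum (term ∘ inj₁) + sum (term ∘ inj₂)
          ≡⟨ translates-sum {g = value ∘ family ∘ inj₁} {value ∘ family ∘ inj₂} Φax≡0 Φay≡0
               (family-translate ∘ inj₁) (family-translate ∘ inj₂) ρ ⟩
        0# ∎
        where
        open ≡-Reasoning
        term : (Fin p ⊎ Fin p) → Fin p
        term k = sign k * value (family k) ρ

    -- Stabilizers of the elements of a finitely supported basis.

    module _ {S : FinitelySupported orbit} {B : 𝕍} (B⊆ : ZFA._⊆_ G B (𝔽^ orbit))
             (B-basis : IsBasis (functionSpace orbit S) (λ f → asSet f ∈ B))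
             {A : List Atom} (A-supports : Supports A B) (⊥a : All (λ c → Φ a (covectorPart c) ≡ 0#) A) where

      A⊥ : Pred V*.Carrierᴹ 0ℓ
      A⊥ b = All (λ c → Φ (vectorPart c) b ≡ 0#) A

      ⊥-isSubspace : L*.IsSubspace (a⊥ ∩ A⊥)
      ⊥-isSubspace = L*.∩-isSubspace a⊥-isSubspace
        (L*.All-isSubspace (λ c → L*.kernel-isSubspace (linearʳ (vectorPart c))) A)

      -- τ_b fixes the support `A` pointwise and hence permutes `B`; the image of `f` is again the
      -- graph of a function by `B⊆`.
      basis-translate : ∀ f → asSet f ∈ B → ∀ {b} → (a⊥ ∩ A⊥) b →
                        Σ[ g ∈ Function orbit ] asSet g ∈ B × Translate b (value f) (value g)
      basis-translate f (i , f≈Bi) {b} (Φab≡0 , b⊥A) = g , (j , ≈-sym Bj≈g) ,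
        λ ρ ρ′ e → value-transport f g σf≈g ρ ρ′ (inj₁ (V.≈ᴹ-sym e))
        where
        σ : Automorphism
        σ = transvection a b Φab≡0
        moved = proj₁ (permutes B {σ} (A-supports σ (transvection-fixes Φab≡0 ⊥a b⊥A))) i
        j = proj₁ moved
        g = proj₁ (B⊆ j)
        Bj≈g : element B j ≈ asSet g
        Bj≈g = proj₂ (B⊆ j)
        σf≈g : σ • asSet f ≈ asSet g
        σf≈g = ≈-trans (•-cong σ f≈Bi) (≈-trans (proj₂ moved) Bj≈g)

      -- Otherwise the 2p translates of `f` would be distinct elements of the basis satisfying a
      -- relation with coefficients 1 and -1.
      stabilizer-corank : ∀ f → asSet f ∈ B → L*.Corank≤1 (a⊥ ∩ A⊥) (Stabilizer f)
      stabilizer-corank f f∈B {x} {y} x⊥ y⊥ (none₁ , none₂) =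
        -- The index `0# ↑ˡ p` lies in the first half, where the coefficient is 1.
        1≢0 (trans (sym (cong D.sign (splitAt-↑ˡ p 0# p)))
          (IsBasis.independent B-basis (family ∘ splitAt p) (λ k → proj₁ (proj₂ (translate (splitAt p k))))
            D.splitFamily-injective (D.sign ∘ splitAt p) D.dependence (0# ↑ˡ p)))
        where
        translate : ∀ k → Σ[ g ∈ Function orbit ] asSet g ∈ B × Translate (covector x y k) (value f) (value g)
        translate k = basis-translate f f∈B (covector-closed ⊥-isSubspace x⊥ y⊥ k)

        family : Fin p ⊎ Fin p → Function orbit
        family = proj₁ ∘ translate

        module D = Dependence S f (proj₁ x⊥) (proj₁ y⊥) family (proj₂ ∘ proj₂ ∘ translate) none₁ none₂

      stabilizers-large : L*.Large U → ∀ {k} (f : Fin k → Function orbit) → (∀ i → asSet (f i) ∈ B) →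
                          L*.Large ((a⊥ ∩ A⊥) ∩ λ b → All (λ i → Stabilizer (f i) b) (allFin k))
      stabilizers-large V*-large {k} f f∈B = L*.large-All ⊥-isSubspace
        -- Prepending the atom `a` to `A` makes orthogonality to `a` one more kernel condition of
        -- corank at most one.
        (L*.large-⊆ (λ { (_ , b⊥a ∷ b⊥A) → b⊥a , b⊥A })
          (L*.large-All L*.U-isSubspace V*-large (λ c → L*.kernel-isSubspace (linearʳ (vectorPart c)))
            (λ c → L*.kernel-corank (linearʳ (vectorPart c))) (inj₁ a ∷ A)))
        (stabilizer-isSubspace ∘ f) (λ i → stabilizer-corank (f i) (f∈B i)) (allFin k)

  -- τ_b changes Φ(v,w) by Φ(v,b)Φ(a,w) = Φ(v,b), which invariance forces to be zero.
  pairing-stabilized : ∀ {a b w} → Translation.Translate a b (value (pairing w)) (value (pairing w)) →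
                  Φ a b ≡ 0# → Φ a w ≡ 1# → ∀ ρ → Φ (point ρ) b ≡ 0#
  pairing-stabilized {a} {b} {w} T Φab≡0 Φaw≡1 ρ = +-identityʳ-unique (Φ v w) (Φ v b) (begin
    Φ v w + Φ v b                    ≡⟨ cong (Φ v w +_) (*-identityʳ _) ⟨
    Φ v w + Φ v b * 1#               ≡⟨ cong (λ t → Φ v w + Φ v b * t) Φaw≡1 ⟨
    Φ v w + Φ v b * Φ a w            ≡⟨ cong (Φ v w +_) (Φˡ.*ₗ-homo w _ a) ⟨
    Φ v w + Φ (Φ v b V.*ₗ a) w       ≡⟨ Φˡ.+ᴹ-homo w v _ ⟨
    Φ (v V.+ᴹ Φ v b V.*ₗ a) w        ≡⟨ T ρ (transvection a b Φab≡0 ∘ᴬ ρ) V.≈ᴹ-refl ⟨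
    Φ v w                            ∎)
    where
    open ≡-Reasoning
    v : V.Carrierᴹ
    v = point ρ

  -- Infinite dimension and the contradiction.

  V-large : L.Large U
  -- Space extension with no prescribed pairing already yields a vector outside `W`.
  V-large W none = let v , v∉W , _ = extend-V* {0} (λ ()) (λ _ _ ()) (λ ()) W in none (v , v∉W , tt)

  V*-large : L*.Large U
  V*-large W none = let w , w∉W , _ = extend-V {0} (λ ()) (λ _ _ ()) (λ ()) W in none (w , w∉W , tt)

  orbit-noBasis : ¬ v₀ V.≈ᴹ V.0ᴹ → ∀ S → ¬ HasZFABasis orbit S
  orbit-noBasis v₀≉0 S (B , B-isZFASet , B⊆ , B-basis) =
    -- The goal is a contradiction, so a doubly negated choice of `a` suffices; excluding the list
    -- of the zero vector makes `a` non-zero.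
    L.large-All L.U-isSubspace V-large (λ c → L.kernel-isSubspace (linearˡ (covectorPart c)))
      (λ c → L.kernel-corank (linearˡ (covectorPart c))) A (V.0ᴹ ∷ [])
    λ (a , a∉ , _ , ⊥a) →
    let w , _ , Φaw≡1 = extend-V {1} (λ _ → a) (L.singleton-independent (a∉ ∘ here)) (λ _ → 1#) []
        k , c , f , f∈B , w≈cf = IsBasis.spanning B-basis (pairing w)
        open Translation a
        -- Invariance passes from the basis elements `f i` to their linear combination Φ(·,w).
        invariant : ∀ {b} → All (λ i → Stabilizer (f i) b) (allFin k) →
                    Translate b (value (pairing w)) (value (pairing w))
        invariant stable = λ ρ ρ′ e → trans (expand (pairing w) c f w≈cf ρ) (trans
          (sum-cong-≗ (λ i → cong (c i *_) (proj₂ (All.lookup stable (∈-allFin i)) ρ ρ′ e)))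
          (sym (expand (pairing w) c f w≈cf ρ′)))
    in stabilizers-large B⊆ B-basis A-supports ⊥a V*-large f f∈B (V*.0ᴹ ∷ [])
    λ (b , b∉ , (b⊥a , _) , stable) →
    -- Since `b` is non-zero, some point of the orbit has non-zero pairing with it, although
    -- invariance makes all such pairings zero.
    let ρ , Φvb≢0 = orbit-separates v₀≉0 (b∉ ∘ here)
    in Φvb≢0 (pairing-stabilized (invariant stable) b⊥a (Φaw≡1 zero) ρ)
    where
    A : List Atom
    A = proj₁ (isZFASet⇒finitelySupported {x = B} B-isZFASet)
    A-supports : Supports A B
    A-supports = proj₂ (isZFASet⇒finitelySupported {x = B} B-isZFASet)

    expand : ∀ g {k} (c : Fin k → Fin p) (f : Fin k → Function orbit) →
             LeftModule._≈ᴹ_ (functionSpace orbit S) g (linearCombination (functionSpace orbit S) c f) →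
             ∀ ρ → value g ρ ≡ sum (λ i → c i * value (f i) ρ)
    expand g c f g≈cf ρ = trans (g≈cf ρ) (value-linearCombination S c f ρ)

mainTheorem14 : (p : ℕ) .{{_ : NonZero p}} → Prime p → (G : PolarGeometry p) →
    let open ZFA G in
    Σ[ X ∈ 𝕍 ] Σ[ isZFASet ∈ IsZFASet X ]
    Definable X × ¬ HasZFABasis X (isZFASet⇒finitelySupported isZFASet)
mainTheorem14 p p-prime G = orbit , orbit-isZFASet , orbit-definable ,
  orbit-noBasis e₀≉0 (ZFA.isZFASet⇒finitelySupported G {x = orbit} orbit-isZFASet)
  where
  open PolarGeometry G
  open PrimeField p p-prime
  open Orbit p-prime G (HasSequenceBasis.e dim-V 0)

  -- A zero basis vector would satisfy a relation with coefficient 1, against independence of the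
  -- one-term initial segment.
  e₀≉0 : ¬ HasSequenceBasis.e dim-V 0 V.≈ᴹ V.0ᴹ
  e₀≉0 e₀≈0 = 1≢0 (HasSequenceBasis.independent dim-V 1 (λ _ → 1#)
    (V.≈ᴹ-trans (V.+ᴹ-identityʳ _) (V.≈ᴹ-trans (V.*ₗ-identityˡ _) e₀≈0)) zero)
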